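{- Let $n \geq 1$, let $x_1,\dots,x_n$, $y_1,\dots,y_n$ and $t$ be indeterminates, and write $\bar{y}_i = 1/y_i$. Then $$ \sum_{\lambda}\prod_{i=1}^{n}\left(1-t^{\lambda_i-i+n+1}\right) s_{\lambda}(x_1,\dots,x_n)\, sp_{\lambda}(y_1,\bar{y}_1,\dots,y_n,\bar{y}_n) $$ $$ = \frac{\prod_{i=1}^{n}(1-t x_i^2)}{\prod_{1\leq i<j\leq n}(x_i-x_j)\ \prod_{1\leq i<j\leq n}(y_i-y_j)\ \prod_{1\leq i<j\leq n}(1-\bar{y}_i\bar{y}_j)} \det\left[\frac{(1-t)}{(1-x_i y_j)(1-t x_i y_j)(1-x_i\bar{y}_j)(1-t x_i\bar{y}_j)}\right]_{1\leq i,j\leq n}, $$ where the sum is over all partitions $\lambda=(\lambda_1\geq\cdots\geq\lambda_n\geq 0)$ with at most $n$ non-zero parts.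
   Context: A partition is a finite weakly decreasing sequence of positive integers (possibly empty); a partition with at most $n$ parts is padded with zeros so that $\lambda_1,\dots,\lambda_n$ are all defined. For a partition $\lambda$ with at most $n$ parts, the Schur polynomial is $$ s_{\lambda}(x_1,\dots,x_n)=\frac{\det\left[x_i^{\lambda_j-j+n}\right]_{1\leq i,j\leq n}}{\prod_{1\leq i<j\leq n}(x_i-x_j)}, $$ and the symplectic character (the irreducible character of $Sp(2n)$ indexed by $\lambda$) is the Laurent polynomial $$ sp_{\lambda}(y_1,\bar{y}_1,\dots,y_n,\bar{y}_n)=\frac{\det\left[y_i^{\lambda_j-j+n+1}-\bar{y}_i^{\,\lambda_j-j+n+1}\right]_{1\leq i,j\leq n}}{\prod_{i=1}^{n}(y_i-\bar{y}_i)\prod_{1\leq i<j\leq n}(y_i-y_j)(1-\bar{y}_i\bar{y}_j)} . $$ The identity is understood as one of formal power series in $x_1,\dots,x_n$ whose coefficients are polynomial in $t$ and Laurent polynomial in $y_1,\dots,y_n$, the entries of the determinant being expanded as power series in the $x_i$. -}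

module Defs where

open import Algebra.Bundles.Raw using (RawRing)
import Algebra.Definitions.RawSemiring as RawSemiringDefinitions
open import Data.Fin.Base using (Fin; zero; suc; toℕ; punchIn)
open import Data.Integer.Base as ℤ using (ℤ)
import Data.Integer.Properties as ℤ
open import Data.List.Base as List using (List; []; _∷_)
open import Data.List.Membership.Propositional using (_∉_)
open import Data.List.Relation.Unary.Unique.Propositional using (Unique)
open import Data.Nat.Base as ℕ using (ℕ; zero; suc; _∸_; _≥_)
import Data.Nat.Properties as ℕ
open import Data.Product.Base using (_×_; _,_; ∃-syntax)
open import Data.Product.Properties using (≡-dec)
open import Data.Vec.Base as Vec using (Vec; []; _∷_)
import Data.Vec.Properties as Vec
open import Data.Vec.Relation.Unary.Linked using (Linked)
open import Level using (Level; 0ℓ)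
open import Relation.Binary.Definitions using (DecidableEquality)
open import Relation.Binary.PropositionalEquality.Core using (_≡_)
open import Relation.Nullary.Decidable using (does)
open import Data.Bool.Base using (if_then_else_)

private
  variable
    c ℓ : Level

module RingOps (R : RawRing c ℓ) where
  open RawRing R public
  open RawSemiringDefinitions rawSemiring public using (_^_; sum; product)

  infixl 6 _-_
  _-_ : Carrier → Carrier → Carrier
  a - b = a + (- b)

  -- The product of f i j over all i < j, split into the pairs with i = 0
  -- and the rest.
  product< : ∀ {n} → (Fin n → Fin n → Carrier) → Carrier
  product< {zero}  f = 1#
  product< {suc n} f =
    product (λ j → f zero (suc j)) * product< (λ i j → f (suc i) (suc j))

  -- Laplace expansion along the first row.
  det : ∀ {n} → (Fin n → Fin n → Carrier) → Carrier
  det {zero}  M = 1#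
  det {suc n} M =
    sum (λ j → (- 1#) ^ toℕ j * M zero j * det (λ i k → M (suc i) (punchIn j k)))

  -- q ≈ a ÷ b says that q is the exact quotient a / b.  All divisors
  -- below are non-zero-divisors, so such a q is unique.
  infix 4 _≈_÷_
  _≈_÷_ : Carrier → Carrier → Carrier → Set ℓ
  q ≈ a ÷ b = q * b ≈ a

-- (k , a) stands for tᵏ y₁^a₁ ⋯ yₙ^aₙ.
Monomial : ℕ → Set
Monomial n = ℕ × Vec ℤ n

infix 4 _≟_
_≟_ : ∀ {n} → DecidableEquality (Monomial n)
_≟_ = ≡-dec ℕ._≟_ (Vec.≡-dec ℤ._≟_)

infixl 7 _·_
_·_ : ∀ {n} → Monomial n → Monomial n → Monomial n
(k , a) · (l , b) = k ℕ.+ l , Vec.zipWith ℤ._+_ a b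

-- A list of terms, read as their formal sum; terms may repeat and
-- coefficients may vanish, so equality compares total coefficients.
Terms : ℕ → Set
Terms n = List (ℤ × Monomial n)

coefficient : ∀ {n} → Terms n → Monomial n → ℤ
coefficient []            m = ℤ.0ℤ
coefficient ((a , u) ∷ p) m =
  (if does (u ≟ m) then a else ℤ.0ℤ) ℤ.+ coefficient p m

infix 4 _≋_
record _≋_ {n} (p q : Terms n) : Set where
  constructor mk≋
  field
    coefficient-≡ : ∀ m → coefficient p m ≡ coefficient q m

-- ℤ[t][y₁^±1, …, yₙ^±1]
Laurent : ℕ → RawRing 0ℓ 0ℓ
Laurent n = record
  { Carrier = Terms n
  ; _≈_     = _≋_
  ; _+_     = List._++_
  ; _*_     = List.cartesianProductWith (λ (a , u) (b , v) → a ℤ.* b , u · v)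
  ; -_      = List.map (λ (a , u) → ℤ.- a , u)
  ; 0#      = []
  ; 1#      = (ℤ.1ℤ , 0 , Vec.replicate n ℤ.0ℤ) ∷ []
  }

-- R[[x]], a series being its sequence of coefficients.
PowerSeries : RawRing c ℓ → RawRing c ℓ
PowerSeries R = record
  { Carrier = ℕ → Carrier
  ; _≈_     = λ f g → ∀ k → f k ≈ g k
  ; _+_     = λ f g k → f k + g k
  ; _*_     = λ f g k → sum (λ (i : Fin (suc k)) → f (toℕ i) * g (k ∸ toℕ i))
  ; -_      = λ f k → - f k
  ; 0#      = λ _ → 0#
  ; 1#      = λ { zero → 1# ; (suc _) → 0# }
  }
  where open RingOps R

-- R[[x₁, …, xₙ]], obtained as R[[xₙ]]⋯[[x₁]].
PowerSeriesIn : ℕ → RawRing c ℓ → RawRing c ℓ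
PowerSeriesIn zero    R = R
PowerSeriesIn (suc n) R = PowerSeries (PowerSeriesIn n R)

module _ (R : RawRing c ℓ) where
  open RingOps R using (Carrier; _≈_; 0#; 1#; _^_)

  Series : ℕ → Set c
  Series n = RawRing.Carrier (PowerSeriesIn n R)

  -- The coefficient of x₁^α₁ ⋯ xₙ^αₙ.
  coeff : ∀ {n} → Series n → Vec ℕ n → Carrier
  coeff f []      = f
  coeff f (k ∷ α) = coeff (f k) α

  const : ∀ n → Carrier → Series n
  const zero    a = a
  const (suc n) a zero    = const n a
  const (suc n) a (suc _) = RawRing.0# (PowerSeriesIn n R)

  var : ∀ {n} → Fin n → Series n
  var {suc n} zero    1 = RawRing.1# (PowerSeriesIn n R)
  var {suc n} zero    _ = RawRing.0# (PowerSeriesIn n R)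
  var {suc n} (suc i) zero    = var i
  var {suc n} (suc i) (suc _) = RawRing.0# (PowerSeriesIn n R)

  -- The expansion Σₖ aᵏ xᵢᵏ of 1 / (1 - a xᵢ).
  geometric : ∀ {n} → Fin n → Carrier → Series n
  geometric {suc n} zero    a k = const n (a ^ k)
  geometric {suc n} (suc i) a zero    = geometric i a
  geometric {suc n} (suc i) a (suc _) = RawRing.0# (PowerSeriesIn n R)

  -- F is the sum of the family f: each monomial occurs in only finitely
  -- many members, and its coefficients there add up to the one in F.
  HasSum : ∀ n {I : Set} → (I → Series n) → Series n → Set ℓ
  HasSum n {I} f F = (α : Vec ℕ n) →
    ∃[ is ] Unique is
          × ((i : I) → i ∉ is → coeff (f i) α ≈ 0#)
          × coeff F α ≈ List.foldr (λ i a → coeff (f i) α + a) 0# is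
    where open RingOps R using (_+_)

-- Partitions with at most n parts, padded with zeros.
record Partition (n : ℕ) : Set where
  constructor partition
  field
    parts      : Vec ℕ n
    decreasing : Linked _≥_ parts

-- λⱼ - j + n for j = 1, …, n; the index j : Fin n counts from 0.
shifted : ∀ {n} → Partition n → Fin n → ℕ
shifted {n} μ j = Vec.lookup (Partition.parts μ) j ℕ.+ (n ∸ suc (toℕ j))

module Coefficients (n : ℕ) where
  open RingOps (Laurent n) public

  t : Carrier
  t = (ℤ.1ℤ , 1 , Vec.replicate n ℤ.0ℤ) ∷ []

  yPower : Fin n → ℤ → Carrier
  yPower i e = (ℤ.1ℤ , 0 , Vec.replicate n ℤ.0ℤ Vec.[ i ]≔ e) ∷ []

  y ȳ : Fin n → Carrier
  y i = yPower i ℤ.1ℤ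
  ȳ i = yPower i ℤ.-1ℤ

  weight : Partition n → Carrier
  weight μ = product (λ i → 1# - t ^ suc (shifted μ i))

  IsSymplecticCharacter : Partition n → Carrier → Set
  IsSymplecticCharacter μ sp =
    sp ≈ det (λ i j → y i ^ suc (shifted μ j) - ȳ i ^ suc (shifted μ j))
       ÷ product (λ i → y i - ȳ i)
         * product< (λ i j → (y i - y j) * (1# - ȳ i * ȳ j))

-- ℤ[t][y₁^±1, …, yₙ^±1][[x₁, …, xₙ]]
module FormalSeries (n : ℕ) where
  open RingOps (PowerSeriesIn n (Laurent n)) public

  module A = Coefficients n
  open A public using (t; y; ȳ; weight; IsSymplecticCharacter)

  ι : A.Carrier → Carrier
  ι = const (Laurent n) n

  x : Fin n → Carrier
  x = var (Laurent n)

  1/[1-_·x_] : A.Carrier → Fin n → Carrier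
  1/[1- a ·x i ] = geometric (Laurent n) i a

  IsSchurPolynomial : Partition n → Carrier → Set
  IsSchurPolynomial μ s =
    s ≈ det (λ i j → x i ^ shifted μ j) ÷ product< (λ i j → x i - x j)

{-# OPTIONS --safe #-}
module Submission where

-- Put l_j = λ_j + n - j + 1.  After clearing denominators the summand indexed by λ is a
-- product of two alternants in the columns l_j, so by the Cauchy-Binet formula the sum is the
-- determinant of Σ_{l ≥ 1} (1 - t^l) x_i^{l-1} (y_j^l - ȳ_j^l), a combination of geometric
-- series equal to (1 - t x_i²) (y_j - ȳ_j) times the kernel on the right.  The row and column
-- factors come out of the determinant, and the y_j - ȳ_j cancel, being non-zero-divisors.
-- Infinite sums are replaced by finite ones modulo series vanishing below total degree m, for
-- every m; this needs that the Schur polynomial of a partition with large first part vanishes to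
-- high order, which holds because dividing by x_i - x_j lowers the order by at most one.

open import Defs
open import Algebra.Bundles using (CommutativeRing)
open import Algebra.Bundles.Raw using (RawRing)
import Algebra.Properties.AbelianGroup as AbelianGroupProperties
import Algebra.Properties.CommutativeMonoid.Sum as MonoidSum
import Algebra.Properties.CommutativeSemigroup as CommutativeSemigroupProperties
import Algebra.Properties.Ring as RingProperties
import Algebra.Properties.Semiring.Sum as SemiringSum
import Algebra.Solver.Ring.NaturalCoefficients.Default as SemiringSolver
open import Algebra.Structures using (IsCommutativeRing)
open import Data.Bool.Base using (if_then_else_)
open import Data.Empty using (⊥-elim)
open import Data.Fin.Base using (Fin; zero; suc; toℕ; punchIn; pinch)
open import Data.Integer.Base as ℤ using (ℤ)
import Data.Integer.Properties as ℤ
open import Data.List.Base as List using (List; []; _∷_; _++_)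
import Data.List.Properties as List
open import Data.List.Membership.Propositional using (_∈_; _∉_)
open import Data.List.Membership.Propositional.Properties using (∈-map⁺; ∈-map⁻; ∈-++⁺ˡ; ∈-++⁺ʳ)
import Data.List.Relation.Unary.All as All
open import Data.List.Relation.Unary.AllPairs using ([]; _∷_)
open import Data.List.Relation.Unary.Any using (here)
open import Data.List.Relation.Unary.Unique.Propositional using (Unique)
import Data.List.Relation.Unary.Unique.Propositional.Properties as Unique
open import Data.Nat.Base as ℕ using (ℕ; zero; suc; _≤_; _<_; _≥_; _∸_; z≤n; s≤s)
import Data.Nat.Properties as ℕ
open import Data.Product.Base using (Σ; _×_; _,_; proj₁; proj₂; ∃-syntax)
open import Data.Vec.Base as Vec using (Vec; []; _∷_; lookup)
import Data.Vec.Properties as Vec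
open import Data.Vec.Relation.Unary.Linked as Linked using (Linked; [-]; _∷_)
open import Function.Base using (_∘_)
open import Level using (Level; _⊔_)
open import Relation.Binary.PropositionalEquality as ≡ using (_≡_)
import Relation.Binary.Reasoning.Setoid as SetoidReasoning
open import Relation.Nullary.Decidable using (does; yes; no)
open import Relation.Nullary.Negation using (¬_)

-- The finite identity for partitions with first part at most `b` is exact: these correspond one to
-- one to the exponents below `b + n`, which are the columns kept in the Cauchy-Binet formula.
-- Errors enter in two places only. The tail of each geometric series is an explicit multiple of a
-- power of `x i`. The tail of the sum over partitions is harder, because `s μ` is known only
-- through its product with the Vandermonde factor, so its order has to be read off from the
-- numerator across a division. Since `det` is a Laplace expansion, no permutations occur. Columns
-- are added one at a time, and the alternating property is used in one form: terms taking a
-- rank-one matrix in two rows cancel in pairs. The claim keeps three of the denominators multiplied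
-- onto the sum. What remains to be cancelled, the product of the `y j - ȳ j`, is constant in the
-- `x i`, so a statement about Laurent polynomials suffices. The factor `1 - t x²` appears when the
-- four geometric series are put over a common denominator, through `y * ȳ = 1`.

private
  variable
    c ℓ c′ ℓ′ r : Level

-- Applied to congruences and to graphs of homomorphisms.
module Related
  (R : RawRing c ℓ) (S : RawRing c′ ℓ′)
  (_~_ : RawRing.Carrier R → RawRing.Carrier S → Set r)
  (0~ : RawRing.0# R ~ RawRing.0# S)
  (1~ : RawRing.1# R ~ RawRing.1# S)
  (+~ : ∀ {x x′ y y′} → x ~ x′ → y ~ y′ → RawRing._+_ R x y ~ RawRing._+_ S x′ y′)
  (*~ : ∀ {x x′ y y′} → x ~ x′ → y ~ y′ → RawRing._*_ R x y ~ RawRing._*_ S x′ y′)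
  (-~ : ∀ {x x′} → x ~ x′ → RawRing.-_ R x ~ RawRing.-_ S x′)
  where

  private
    module R = RingOps R
    module S = RingOps S

  ^~ : ∀ {x x′} k → x ~ x′ → (x R.^ k) ~ (x′ S.^ k)
  ^~ zero    p = 1~
  ^~ (suc k) p = *~ p (^~ k p)

  sum~ : ∀ {n} {f : Fin n → R.Carrier} {g : Fin n → S.Carrier} →
         (∀ i → f i ~ g i) → R.sum f ~ S.sum g
  sum~ {zero}  p = 0~
  sum~ {suc n} p = +~ (p zero) (sum~ (λ i → p (suc i)))

  product~ : ∀ {n} {f : Fin n → R.Carrier} {g : Fin n → S.Carrier} →
             (∀ i → f i ~ g i) → R.product f ~ S.product g
  product~ {zero}  p = 1~
  product~ {suc n} p = *~ (p zero) (product~ (λ i → p (suc i)))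

  det~ : ∀ {n} {f : Fin n → Fin n → R.Carrier} {g : Fin n → Fin n → S.Carrier} →
         (∀ i j → f i j ~ g i j) → R.det f ~ S.det g
  det~ {zero}  p = 1~
  det~ {suc n} p = sum~ λ j →
    *~ (*~ (^~ (toℕ j) (-~ 1~)) (p zero j))
       (det~ (λ i k → p (suc i) (punchIn j k)))

IsCommRing : RawRing c ℓ → Set (c ⊔ ℓ)
IsCommRing R = IsCommutativeRing _≈_ _+_ _*_ -_ 0# 1#
  where open RawRing R

module CommRing (R : RawRing c ℓ) (isCommRing : IsCommRing R) where
  open RingOps R public

  commutativeRing : CommutativeRing c ℓ
  commutativeRing = record { isCommutativeRing = isCommRing }

  open CommutativeRing commutativeRing public
    using ( refl; sym; trans; reflexive; setoid; semiring; ring; commutativeSemiring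
          ; *-commutativeMonoid
          ; +-cong; +-congˡ; +-congʳ; +-assoc; +-comm; +-identityˡ; +-identityʳ
          ; *-cong; *-congˡ; *-congʳ; *-assoc; *-comm; *-identityˡ; *-identityʳ
          ; distribˡ; distribʳ; zeroˡ; zeroʳ; -‿cong; -‿inverseˡ; -‿inverseʳ )
  open RingProperties ring public
    using (-‿distribˡ-*; -‿distribʳ-*; -‿+-comm; -0#≈0#; -‿involutive; -1*x≈-x; x[y-z]≈xy-xz; [y-z]x≈yx-zx)
  open SemiringSum semiring public
    using (*-distribˡ-sum; *-distribʳ-sum; ∑-distrib-+; ∑-comm; sum-replicate-zero)
  module ≈-Reasoning = SetoidReasoning setoid
  open SemiringSolver commutativeSemiring public using (solve; _:+_; _:*_; _:=_; con)
  open Related R R _≈_ refl refl +-cong *-cong -‿cong public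
    using ()
    renaming (sum~ to sum-cong; det~ to det-cong)

-- Determinants

-- Once the index `punchIn j k` is removed, `j` sits at position `pinch k j` among the rest.
punchIn-punchIn-pinch : ∀ {n} (j : Fin (suc n)) (k : Fin n) →
  punchIn (punchIn j k) (pinch k j) ≡ j
punchIn-punchIn-pinch zero    zero    = ≡.refl
punchIn-punchIn-pinch zero    (suc k) = ≡.refl
punchIn-punchIn-pinch (suc j) zero    = ≡.refl
punchIn-punchIn-pinch (suc j) (suc k) = ≡.cong suc (punchIn-punchIn-pinch j k)

-- Removing two columns one after the other leaves the same columns in either order.
punchIn-exchange : ∀ {n} (j : Fin (suc (suc n))) (k : Fin (suc n)) (i : Fin n) →
  punchIn (punchIn j k) (punchIn (pinch k j) i) ≡ punchIn j (punchIn k i)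
punchIn-exchange zero    zero    i       = ≡.refl
punchIn-exchange zero    (suc k) i       = ≡.refl
punchIn-exchange (suc j) zero    i       = ≡.refl
punchIn-exchange (suc j) (suc k) zero    = ≡.refl
punchIn-exchange (suc j) (suc k) (suc i) = ≡.cong suc (punchIn-exchange j k i)

module Determinants (R : RawRing c ℓ) (isCommRing : IsCommRing R) where
  open CommRing R isCommRing
  open ≈-Reasoning

  sign : ∀ {n} → Fin n → Carrier
  sign i = (- 1#) ^ toℕ i

  -- Induction on the size: after expansion along row zero, each minor is expanded along its column
  -- zero and the two sums are interchanged. The summand of the corner entry is the same on both
  -- sides.
  det-column : ∀ {n} (M : Fin (suc n) → Fin (suc n) → Carrier) →
    det M ≈ sum (λ i → sign i * M i zero * det (λ k j → M (punchIn i k) (suc j)))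
  det-column {zero}  M = refl
  det-column {suc n} M = +-congˡ (begin
    sum (λ j → sign (suc j) * M zero (suc j) * det (λ i k → M (suc i) (punchIn (suc j) k)))
      ≈⟨ sum-cong (λ j → trans
           (*-congˡ (det-column (λ i k → M (suc i) (punchIn (suc j) k))))
           (*-distribˡ-sum (sign (suc j) * M zero (suc j))
                           (λ i → sign i * M (suc i) zero * minor i j))) ⟩
    sum (λ j → sum (λ i → sign (suc j) * M zero (suc j) * (sign i * M (suc i) zero * minor i j)))
      ≈⟨ ∑-comm (λ j i → sign (suc j) * M zero (suc j) * (sign i * M (suc i) zero * minor i j)) ⟩
    sum (λ i → sum (λ j → sign (suc j) * M zero (suc j) * (sign i * M (suc i) zero * minor i j)))
      ≈⟨ sum-cong (λ i → trans
           (sum-cong (λ j → solve 6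
             (λ e s a t b d → (e :* s) :* a :* (t :* b :* d) := (e :* t) :* b :* (s :* a :* d))
             refl (- 1#) (sign j) (M zero (suc j)) (sign i) (M (suc i) zero) (minor i j)))
           (sym (*-distribˡ-sum (sign (suc i) * M (suc i) zero)
                                (λ j → sign j * M zero (suc j) * minor i j)))) ⟩
    sum (λ i → sign (suc i) * M (suc i) zero * det (λ k j → M (punchIn (suc i) k) (suc j)))
      ∎)
    where
    minor : Fin (suc n) → Fin (suc n) → Carrier
    minor i j = det (λ k l → M (suc (punchIn i k)) (suc (punchIn j l)))

  -- (j , k) ↦ (punchIn j k , pinch k j) exchanges the two members of the pair
  -- of distinct indices (j , punchIn j k).
  sum-exchange : ∀ {n} (g : Fin (suc n) → Fin n → Carrier) →
    sum (λ j → sum (g j)) ≈ sum (λ j → sum (λ k → g (punchIn j k) (pinch k j)))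
  sum-exchange {zero}  g = refl
  sum-exchange {suc n} g = begin
    sum (g zero) + sum (λ j → g (suc j) zero + sum (λ k → g (suc j) (suc k)))
      ≈⟨ +-congˡ (∑-distrib-+ (λ j → g (suc j) zero) (λ j → sum (λ k → g (suc j) (suc k)))) ⟩
    sum (g zero) + (sum (λ j → g (suc j) zero) + sum (λ j → sum (λ k → g (suc j) (suc k))))
      ≈⟨ +-congˡ (+-congˡ (sum-exchange (λ j k → g (suc j) (suc k)))) ⟩
    sum (g zero) + (sum (λ j → g (suc j) zero) + rest)
      ≈⟨ solve 3 (λ a b d → a :+ (b :+ d) := b :+ (a :+ d)) refl _ _ _ ⟩
    sum (λ j → g (suc j) zero) + (sum (g zero) + rest)
      ≈⟨ +-congˡ (∑-distrib-+ (g zero) (λ j → sum (λ k → g (suc (punchIn j k)) (suc (pinch k j))))) ⟨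
    sum (λ j → sum (λ k → g (punchIn j k) (pinch k j))) ∎
    where
    rest : Carrier
    rest = sum (λ j → sum (λ k → g (suc (punchIn j k)) (suc (pinch k j))))

  -- Reversing all pairs would show only that the sum equals its negative. Instead the pairs
  -- containing index 0 cancel one by one against their reversals, and the others are left to the
  -- induction, so nothing has to be divided by 2.
  sum-antisymmetric : ∀ {n} (g : Fin (suc n) → Fin n → Carrier) →
    (∀ j k → g (punchIn j k) (pinch k j) ≈ - g j k) →
    sum (λ j → sum (g j)) ≈ 0#
  sum-antisymmetric {zero}  g anti = +-identityʳ 0#
  sum-antisymmetric {suc n} g anti = begin
    sum (g zero) + sum (λ j → g (suc j) zero + sum (λ k → g (suc j) (suc k)))
      ≈⟨ +-congˡ (∑-distrib-+ (λ j → g (suc j) zero) (λ j → sum (λ k → g (suc j) (suc k)))) ⟩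
    sum (g zero) + (sum (λ j → g (suc j) zero) + sum (λ j → sum (λ k → g (suc j) (suc k))))
      ≈⟨ +-congˡ (+-congˡ (sum-antisymmetric (λ j k → g (suc j) (suc k))
                             (λ j k → anti (suc j) (suc k)))) ⟩
    sum (g zero) + (sum (λ j → g (suc j) zero) + 0#)
      ≈⟨ +-congˡ (+-identityʳ _) ⟩
    sum (g zero) + sum (λ j → g (suc j) zero)
      ≈⟨ ∑-distrib-+ (g zero) (λ j → g (suc j) zero) ⟨
    sum (λ j → g zero j + g (suc j) zero)
      ≈⟨ sum-cong (λ j → trans (+-congˡ (anti zero j)) (-‿inverseʳ _)) ⟩
    sum {suc n} (λ _ → 0#)
      ≈⟨ sum-replicate-zero (suc n) ⟩
    0# ∎

  -- The sum of the two positions changes by one: for `j ≤ k` the new positions are `k + 1` and `j`,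
  -- for `k < j` they are `k` and `j - 1`.
  sign-exchange : ∀ {n} (j : Fin (suc n)) (k : Fin n) →
    sign (punchIn j k) * sign (pinch k j) ≈ - 1# * (sign j * sign k)
  sign-exchange zero    zero    =
    solve 1 (λ e → (e :* con 1) :* con 1 := e :* (con 1 :* con 1)) refl _
  sign-exchange zero    (suc k) =
    solve 2 (λ e s → (e :* s) :* con 1 := e :* (con 1 :* s)) refl _ _
  sign-exchange (suc j) zero    = begin
    1# * sign j                 ≈⟨ *-congʳ (-‿involutive 1#) ⟨
    - (- 1#) * sign j           ≈⟨ *-congʳ (-1*x≈-x (- 1#)) ⟨
    - 1# * - 1# * sign j
      ≈⟨ solve 2 (λ e s → e :* e :* s := e :* ((e :* s) :* con 1)) refl _ _ ⟩
    - 1# * (- 1# * sign j * 1#) ∎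
  sign-exchange (suc j) (suc k) = begin
    (- 1# * sign (punchIn j k)) * (- 1# * sign (pinch k j))
      ≈⟨ interchange _ _ ⟩
    - 1# * - 1# * (sign (punchIn j k) * sign (pinch k j))
      ≈⟨ *-congˡ (sign-exchange j k) ⟩
    - 1# * - 1# * (- 1# * (sign j * sign k))
      ≈⟨ solve 3 (λ e a b → e :* e :* (e :* (a :* b)) := e :* ((e :* a) :* (e :* b)))
           refl _ _ _ ⟩
    - 1# * ((- 1# * sign j) * (- 1# * sign k)) ∎
    where
    interchange : ∀ a b → (- 1# * a) * (- 1# * b) ≈ - 1# * - 1# * (a * b)
    interchange = solve 3 (λ e a b → (e :* a) :* (e :* b) := e :* e :* (a :* b)) refl (- 1#)

module _ (R : RawRing c ℓ) (isCommRing : IsCommRing R) where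
  open CommRing R isCommRing
  open Determinants R isCommRing
  open ≈-Reasoning

  -- The matrix determinant lemma, with cofactors in place of an inverse. The determinant is
  -- multilinear in the rows, and terms using the rank-one part in two rows vanish because these
  -- rows are proportional. By induction a minor has only a constant and a linear part, so a single
  -- quadratic sum, `T₄`, has to be shown to be zero.
  det-rankOne : ∀ {n} (C : Fin (suc n) → Fin (suc n) → Carrier) (a b : Fin (suc n) → Carrier) →
    det (λ i j → C i j + a i * b j)
      ≈ det C + sum (λ i → sum (λ j → sign i * a i * (sign j * b j)
                                      * det (λ p q → C (punchIn i p) (punchIn j q))))
  det-rankOne {zero}  C a b =
    solve 3 (λ m x y → con 1 :* (m :+ x :* y) :* con 1 :+ con 0
                     := (con 1 :* m :* con 1 :+ con 0)
                        :+ (con 1 :* x :* (con 1 :* y) :* con 1 :+ con 0 :+ con 0))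
          refl (C zero zero) (a zero) (b zero)
  det-rankOne {suc n} C a b = begin
    sum (λ j → sign j * (C zero j + a zero * b j)
               * det (λ p q → C (suc p) (punchIn j q) + a (suc p) * b (punchIn j q)))
      ≈⟨ sum-cong (λ j → trans
           (*-congˡ (det-rankOne (λ p q → C (suc p) (punchIn j q))
                                 (a ∘ suc) (b ∘ punchIn j)))
           (solve 6 (λ s m x y d z → s :* (m :+ x :* y) :* (d :+ z)
               := s :* m :* d :+ (con 1 :* x :* (s :* y) :* d
                                  :+ (s :* m :* z :+ x :* (s :* y :* z))))
             refl (sign j) (C zero j) (a zero) (b j) (D j) (X j))) ⟩
    sum (λ j → T₁ j + (T₂ j + (T₃ j + T₄ j)))
      ≈⟨ trans (∑-distrib-+ T₁ (λ j → T₂ j + (T₃ j + T₄ j)))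
           (+-congˡ (trans (∑-distrib-+ T₂ (λ j → T₃ j + T₄ j))
             (+-congˡ (∑-distrib-+ T₃ T₄)))) ⟩
    sum T₁ + (sum T₂ + (sum T₃ + sum T₄))
      ≈⟨ +-congˡ (+-congˡ (trans (+-cong T₃-sum T₄-sum) (+-identityʳ _))) ⟩
    det C + sum (λ i → sum (λ j → sign i * a i * (sign j * b j)
                                  * det (λ p q → C (punchIn i p) (punchIn j q)))) ∎
    where
    D : Fin (suc (suc n)) → Carrier
    D j = det (λ p q → C (suc p) (punchIn j q))

    E : Fin (suc n) → Fin (suc (suc n)) → Fin (suc n) → Carrier
    E i j k = det (λ p q → C (suc (punchIn i p)) (punchIn j (punchIn k q)))

    Y : Fin (suc (suc n)) → Fin (suc n) → Fin (suc n) → Carrier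
    Y j i k = sign i * a (suc i) * (sign k * b (punchIn j k)) * E i j k

    -- `T₁` takes the rank-one part in no row, `T₂` in row zero, `T₃` in one later row, `T₄` in row
    -- zero and one later row.
    X T₁ T₂ T₃ T₄ : Fin (suc (suc n)) → Carrier
    X j = sum (λ i → sum (λ k → Y j i k))
    T₁ j = sign j * C zero j * D j
    T₂ j = 1# * a zero * (sign j * b j) * D j
    T₃ j = sign j * C zero j * X j
    T₄ j = a zero * (sign j * b j * X j)

    -- Common form of `T₃` and `T₄` with the later row `i` fixed: `h` is row zero of `C` or, up to
    -- the factor `a zero`, of the rank-one part. The pair `j`, `punchIn j k` runs over ordered
    -- pairs of distinct columns.
    W : (Fin (suc (suc n)) → Carrier) → Fin (suc n) →
        Fin (suc (suc n)) → Fin (suc n) → Carrier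
    W h i j k = sign j * sign k * (h j * b (punchIn j k)) * E i j k

    E-exchange : ∀ i j k → E i (punchIn j k) (pinch k j) ≈ E i j k
    E-exchange i j k = det-cong (λ p q →
      reflexive (≡.cong (C (suc (punchIn i p))) (punchIn-exchange j k q)))

    W-exchange : ∀ h i j k → W h i (punchIn j k) (pinch k j)
                   ≈ - 1# * (sign j * sign k) * (h (punchIn j k) * b j) * E i j k
    W-exchange h i j k =
      *-cong (*-cong (sign-exchange j k)
                     (*-congˡ (reflexive (≡.cong b (punchIn-punchIn-pinch j k)))))
             (E-exchange i j k)

    pull : ∀ h → sum (λ j → sign j * h j * X j)
                 ≈ sum (λ i → sign i * a (suc i) * sum (λ j → sum (λ k → W h i j k)))
    pull h = begin
      sum (λ j → sign j * h j * X j)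
        ≈⟨ sum-cong (λ j → trans (*-distribˡ-sum (sign j * h j) (λ i → sum (λ k → Y j i k)))
             (sum-cong (λ i → trans (*-distribˡ-sum (sign j * h j) (λ k → Y j i k))
               (trans (sum-cong (λ k → solve 7
                 (λ s g t u v w e → s :* g :* (t :* u :* (v :* w) :* e)
                                    := t :* u :* (s :* v :* (g :* w) :* e)) refl
                 (sign j) (h j) (sign i) (a (suc i)) (sign k) (b (punchIn j k)) (E i j k)))
               (sym (*-distribˡ-sum (sign i * a (suc i)) (λ k → W h i j k))))))) ⟩
      sum (λ j → sum (λ i → sign i * a (suc i) * sum (λ k → W h i j k)))
        ≈⟨ ∑-comm (λ j i → sign i * a (suc i) * sum (λ k → W h i j k)) ⟩
      sum (λ i → sum (λ j → sign i * a (suc i) * sum (λ k → W h i j k)))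
        ≈⟨ sum-cong (λ i → sym (*-distribˡ-sum (sign i * a (suc i)) (λ j → sum (λ k → W h i j k)))) ⟩
      sum (λ i → sign i * a (suc i) * sum (λ j → sum (λ k → W h i j k))) ∎

    T₄-sum : sum T₄ ≈ 0#
    T₄-sum = begin
      sum T₄
        ≈⟨ *-distribˡ-sum (a zero) (λ j → sign j * b j * X j) ⟨
      a zero * sum (λ j → sign j * b j * X j)
        ≈⟨ *-congˡ (pull b) ⟩
      a zero * sum (λ i → sign i * a (suc i) * sum (λ j → sum (λ k → W b i j k)))
        ≈⟨ *-congˡ (sum-cong (λ i → trans
             (*-congˡ {sign i * a (suc i)} (sum-antisymmetric (W b i) (anti i))) (zeroʳ _))) ⟩
      a zero * sum {suc n} (λ _ → 0#)
        ≈⟨ trans (*-congˡ (sum-replicate-zero (suc n))) (zeroʳ _) ⟩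
      0# ∎
      where
      anti : ∀ i j k → W b i (punchIn j k) (pinch k j) ≈ - W b i j k
      anti i j k = trans (W-exchange b i j k) (trans
        (solve 6 (λ e s t u v d → e :* (s :* t) :* (u :* v) :* d := e :* (s :* t :* (v :* u) :* d))
          refl (- 1#) (sign j) (sign k) (b (punchIn j k)) (b j) (E i j k))
        (-1*x≈-x _))

    -- Exchanging the two columns brings the column of the rank-one entry to the outer sum; the
    -- inner sum is then the expansion along row zero of the minor `F i j`.
    T₃-sum : sum T₃ ≈ sum (λ i → sum (λ j → sign (suc i) * a (suc i) * (sign j * b j)
                            * det (λ p q → C (punchIn (suc i) p) (punchIn j q))))
    T₃-sum = begin
      sum (λ j → sign j * C zero j * X j)
        ≈⟨ pull (C zero) ⟩
      sum (λ i → sign i * a (suc i) * sum (λ j → sum (λ k → W (C zero) i j k)))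
        ≈⟨ sum-cong (λ i → trans
             (*-congˡ {sign i * a (suc i)} (trans (sum-exchange (W (C zero) i))
               (sum-cong (λ j → trans (sum-cong (λ k → term i j k))
                 (sym (*-distribˡ-sum (- 1# * (sign j * b j))
                         (λ k → sign k * C zero (punchIn j k) * E i j k)))))))
             (trans (*-distribˡ-sum (sign i * a (suc i)) (λ j → - 1# * (sign j * b j) * F i j))
               (sum-cong (λ j → solve 6
                 (λ e s x t y f → s :* x :* (e :* (t :* y) :* f) := e :* s :* x :* (t :* y) :* f)
                 refl (- 1#) (sign i) (a (suc i)) (sign j) (b j) (F i j))))) ⟩
      sum (λ i → sum (λ j → sign (suc i) * a (suc i) * (sign j * b j) * F i j)) ∎
      where
      F : Fin (suc n) → Fin (suc (suc n)) → Carrier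
      F i j = det (λ p q → C (punchIn (suc i) p) (punchIn j q))

      term : ∀ i j k → W (C zero) i (punchIn j k) (pinch k j)
               ≈ - 1# * (sign j * b j) * (sign k * C zero (punchIn j k) * E i j k)
      term i j k = trans (W-exchange (C zero) i j k)
        (solve 6 (λ e s t u v d → e :* (s :* t) :* (u :* v) :* d
                                  := e :* (s :* v) :* (t :* u :* d))
          refl (- 1#) (sign j) (sign k) (C zero (punchIn j k)) (b j) (E i j k))

  det-scaleRows : ∀ {n} (r : Fin n → Carrier) (M : Fin n → Fin n → Carrier) →
    det (λ i j → r i * M i j) ≈ product r * det M
  det-scaleRows {zero}  r M = sym (*-identityˡ _)
  det-scaleRows {suc n} r M = begin
    sum (λ j → sign j * (r zero * M zero j) * det (λ p q → r (suc p) * M (suc p) (punchIn j q)))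
      ≈⟨ sum-cong (λ j → trans
           (*-congˡ (det-scaleRows (r ∘ suc) (λ p q → M (suc p) (punchIn j q))))
           (solve 5 (λ s x m y d → s :* (x :* m) :* (y :* d) := x :* y :* (s :* m :* d))
              refl (sign j) (r zero) (M zero j) (product (r ∘ suc)) (D j))) ⟩
    sum (λ j → product r * (sign j * M zero j * D j))
      ≈⟨ *-distribˡ-sum (product r) (λ j → sign j * M zero j * D j) ⟨
    product r * det M ∎
    where
    D : Fin (suc n) → Carrier
    D j = det (λ p q → M (suc p) (punchIn j q))

  det-scaleColumns : ∀ {n} (r : Fin n → Carrier) (M : Fin n → Fin n → Carrier) →
    det (λ i j → r j * M i j) ≈ product r * det M
  det-scaleColumns {zero}  r M = sym (*-identityˡ _)
  det-scaleColumns {suc n} r M = begin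
    sum (λ j → sign j * (r j * M zero j) * det (λ p q → r (punchIn j q) * M (suc p) (punchIn j q)))
      ≈⟨ sum-cong (λ j → trans
           (*-congˡ (det-scaleColumns (r ∘ punchIn j) (λ p q → M (suc p) (punchIn j q))))
           (trans
           (solve 5 (λ s x m y d → s :* (x :* m) :* (y :* d) := x :* y :* (s :* m :* d))
              refl (sign j) (r j) (M zero j) (product (r ∘ punchIn j)) (D j))
           (*-congʳ (sym (MonoidSum.sum-remove *-commutativeMonoid {i = j} r))))) ⟩
    sum (λ j → product r * (sign j * M zero j * D j))
      ≈⟨ *-distribˡ-sum (product r) (λ j → sign j * M zero j * D j) ⟨
    product r * det M ∎
    where
    D : Fin (suc n) → Carrier
    D j = det (λ p q → M (suc p) (punchIn j q))

-- Finite sums and the Cauchy-Binet formula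

sumOver : (R : RawRing c ℓ) {X : Set c′} → List X → (X → RawRing.Carrier R) → RawRing.Carrier R
sumOver R xs f = List.foldr (λ x a → RawRing._+_ R (f x) a) (RawRing.0# R) xs

-- The sets of `n` columns below the bound, each listed in decreasing order and sorted by whether
-- the last available column belongs to it.
strictlyDecreasing : ∀ n → ℕ → List (Vec ℕ n)
strictlyDecreasing zero    m       = [] ∷ []
strictlyDecreasing (suc n) zero    = []
strictlyDecreasing (suc n) (suc m) =
  List.map (m ∷_) (strictlyDecreasing n m) ++ strictlyDecreasing (suc n) m

module FiniteSums (R : RawRing c ℓ) (isCommRing : IsCommRing R) where
  open CommRing R isCommRing
  open ≈-Reasoning

  Σ[_] : {X : Set c′} → List X → (X → Carrier) → Carrier
  Σ[ xs ] f = sumOver R xs f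

  Σ-cong : {X : Set c′} (xs : List X) {f g : X → Carrier} →
           (∀ x → f x ≈ g x) → Σ[ xs ] f ≈ Σ[ xs ] g
  Σ-cong []       p = refl
  Σ-cong (x ∷ xs) p = +-cong (p x) (Σ-cong xs p)

  Σ-zero : {X : Set c′} (xs : List X) {f : X → Carrier} →
           (∀ x → f x ≈ 0#) → Σ[ xs ] f ≈ 0#
  Σ-zero []       p = refl
  Σ-zero (x ∷ xs) p = trans (+-cong (p x) (Σ-zero xs p)) (+-identityˡ 0#)

  Σ-map : {X : Set c′} {Y : Set ℓ′} (h : X → Y) (xs : List X) (f : Y → Carrier) →
          Σ[ List.map h xs ] f ≈ Σ[ xs ] (f ∘ h)
  Σ-map h []       f = refl
  Σ-map h (x ∷ xs) f = +-congˡ (Σ-map h xs f)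

  Σ-++ : {X : Set c′} (xs ys : List X) (f : X → Carrier) →
         Σ[ xs ++ ys ] f ≈ Σ[ xs ] f + Σ[ ys ] f
  Σ-++ []       ys f = sym (+-identityˡ _)
  Σ-++ (x ∷ xs) ys f = trans (+-congˡ (Σ-++ xs ys f)) (sym (+-assoc _ _ _))

  Σ-distribˡ : {X : Set c′} (xs : List X) (a : Carrier) (f : X → Carrier) →
               Σ[ xs ] (λ x → a * f x) ≈ a * Σ[ xs ] f
  Σ-distribˡ []       a f = sym (zeroʳ a)
  Σ-distribˡ (x ∷ xs) a f = trans (+-congˡ (Σ-distribˡ xs a f)) (sym (distribˡ a _ _))

  Σ-sum : {X : Set c′} (xs : List X) {n : ℕ} (f : X → Fin n → Carrier) →
          Σ[ xs ] (λ x → sum (f x)) ≈ sum (λ i → Σ[ xs ] (λ x → f x i))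
  Σ-sum []       {n} f = sym (sum-replicate-zero n)
  Σ-sum (x ∷ xs) f =
    trans (+-congˡ (Σ-sum xs f)) (sym (∑-distrib-+ (f x) (λ i → Σ[ xs ] (λ z → f z i))))

  -- The last term is split off, so that raising the bound by one is by definition the rank-one
  -- update in the induction for `cauchy-binet`.
  sumBelow : ℕ → (ℕ → Carrier) → Carrier
  sumBelow zero    f = 0#
  sumBelow (suc m) f = sumBelow m f + f m

module _ (R : RawRing c ℓ) (isCommRing : IsCommRing R) where
  open CommRing R isCommRing
  open Determinants R isCommRing
  open FiniteSums R isCommRing
  open ≈-Reasoning

  -- Raising the bound from m to m + 1 adds a rank-one matrix on the right and the
  -- sequences starting with m on the left; both sides then change by the same
  -- combination of minors.
  cauchy-binet : ∀ n m (a b : Fin n → ℕ → Carrier) →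
    Σ[ strictlyDecreasing n m ] (λ l → det (λ i j → a i (lookup l j))
                                     * det (λ i j → b i (lookup l j)))
      ≈ det (λ i j → sumBelow m (λ l → a i l * b j l))
  cauchy-binet zero    m a b = trans (+-identityʳ _) (*-identityˡ _)
  cauchy-binet (suc n) zero a b = sym (trans
    (sum-cong {suc n} (λ j → trans (*-congʳ (zeroʳ (sign j))) (zeroˡ (det {n} (λ _ _ → 0#)))))
    (sum-replicate-zero (suc n)))
  cauchy-binet (suc n) (suc m) a b = begin
    Σ[ List.map (m ∷_) (strictlyDecreasing n m) ++ strictlyDecreasing (suc n) m ] φ
      ≈⟨ trans (Σ-++ (List.map (m ∷_) L) (strictlyDecreasing (suc n) m) φ)
           (+-cong (Σ-map (m ∷_) L φ) (cauchy-binet (suc n) m a b)) ⟩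
    Σ[ L ] (λ l → φ (m ∷ l)) + det C
      ≈⟨ +-congʳ leading ⟩
    sum (λ i → sum (λ k → sign i * a i m * (sign k * b k m)
                          * det (λ p q → C (punchIn i p) (punchIn k q)))) + det C
      ≈⟨ +-comm _ _ ⟩
    det C + sum (λ i → sum (λ k → sign i * a i m * (sign k * b k m)
                                  * det (λ p q → C (punchIn i p) (punchIn k q))))
      ≈⟨ det-rankOne R isCommRing C (λ i → a i m) (λ k → b k m) ⟨
    det (λ i j → C i j + a i m * b j m) ∎
    where
    L : List (Vec ℕ n)
    L = strictlyDecreasing n m

    φ : Vec ℕ (suc n) → Carrier
    φ l = det (λ i j → a i (lookup l j)) * det (λ i j → b i (lookup l j))

    C : Fin (suc n) → Fin (suc n) → Carrier
    C i j = sumBelow m (λ l → a i l * b j l)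

    A B : Fin (suc n) → Vec ℕ n → Carrier
    A i l = det (λ p q → a (punchIn i p) (lookup l q))
    B i l = det (λ p q → b (punchIn i p) (lookup l q))

    coefficients : Fin (suc n) → Fin (suc n) → Carrier
    coefficients i k = sign i * a i m * (sign k * b k m)

    -- The largest index comes first in `m ∷ l`, so the new column `m` is column zero of both
    -- matrices and `det-column` removes it.
    expand : ∀ l → φ (m ∷ l) ≈ sum (λ i → sum (λ k → coefficients i k * (A i l * B k l)))
    expand l = begin
      φ (m ∷ l)
        ≈⟨ *-cong (det-column (λ i j → a i (lookup (m ∷ l) j)))
                  (det-column (λ i j → b i (lookup (m ∷ l) j))) ⟩
      sum (λ i → sign i * a i m * A i l) * sum (λ k → sign k * b k m * B k l)
        ≈⟨ *-distribʳ-sum (sum (λ k → sign k * b k m * B k l)) (λ i → sign i * a i m * A i l) ⟩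
      sum (λ i → sign i * a i m * A i l * sum (λ k → sign k * b k m * B k l))
        ≈⟨ sum-cong (λ i → trans
             (*-distribˡ-sum (sign i * a i m * A i l) (λ k → sign k * b k m * B k l))
             (sum-cong (λ k → solve 4 (λ s x t y → s :* x :* (t :* y) := s :* t :* (x :* y))
               refl (sign i * a i m) (A i l) (sign k * b k m) (B k l)))) ⟩
      sum (λ i → sum (λ k → coefficients i k * (A i l * B k l))) ∎

    leading : Σ[ L ] (λ l → φ (m ∷ l))
      ≈ sum (λ i → sum (λ k → coefficients i k * det (λ p q → C (punchIn i p) (punchIn k q))))
    leading = begin
      Σ[ L ] (λ l → φ (m ∷ l))
        ≈⟨ Σ-cong L expand ⟩
      Σ[ L ] (λ l → sum (λ i → sum (λ k → coefficients i k * (A i l * B k l))))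
        ≈⟨ Σ-sum L (λ l i → sum (λ k → coefficients i k * (A i l * B k l))) ⟩
      sum (λ i → Σ[ L ] (λ l → sum (λ k → coefficients i k * (A i l * B k l))))
        ≈⟨ sum-cong (λ i → trans (Σ-sum L (λ l k → coefficients i k * (A i l * B k l)))
             (sum-cong (λ k → trans
               (Σ-distribˡ L (coefficients i k) (λ l → A i l * B k l))
               (*-congˡ {coefficients i k}
                 (cauchy-binet n m (a ∘ punchIn i) (b ∘ punchIn k)))))) ⟩
      sum (λ i → sum (λ k → coefficients i k * det (λ p q → C (punchIn i p) (punchIn k q)))) ∎

-- Laurent polynomials

module LaurentRing (n : ℕ) where
  open RawRing (Laurent n)
  open ≡.≡-Reasoning

  private
    module ℤ+ = CommutativeSemigroupProperties ℤ.+-commutativeSemigroup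

  ·-assoc : (u v w : Monomial n) → (u · v) · w ≡ u · (v · w)
  ·-assoc (k , a) (l , b) (m , d) =
    ≡.cong₂ _,_ (ℕ.+-assoc k l m) (Vec.zipWith-assoc ℤ.+-assoc a b d)

  ·-comm : (u v : Monomial n) → u · v ≡ v · u
  ·-comm (k , a) (l , b) = ≡.cong₂ _,_ (ℕ.+-comm k l) (Vec.zipWith-comm ℤ.+-comm a b)

  ε : Monomial n
  ε = 0 , Vec.replicate n ℤ.0ℤ

  ·-identityˡ : (u : Monomial n) → ε · u ≡ u
  ·-identityˡ (k , a) = ≡.cong (k ,_) (Vec.zipWith-identityˡ ℤ.+-identityˡ a)

  -- The exponents of the `y` are integers, so only the exponent of `t` can obstruct the division of
  -- `m` by `u`.
  quotient : (u m : Monomial n) → proj₁ u ≤ proj₁ m → ∃[ w ] u · w ≡ m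
  quotient (k , a) (l , b) k≤l =
    (l ∸ k , Vec.zipWith ℤ._-_ b a) , ≡.cong₂ _,_ (ℕ.m+[n∸m]≡n k≤l) (cancel a b)
    where
    cancel : ∀ {m} (a b : Vec ℤ m) → Vec.zipWith ℤ._+_ a (Vec.zipWith ℤ._-_ b a) ≡ b
    cancel []      []      = ≡.refl
    cancel (i ∷ a) (j ∷ b) = ≡.cong₂ _∷_
      (≡.trans (ℤ.+-comm i (j ℤ.- i)) (≡.trans (ℤ.+-assoc j (ℤ.- i) i)
        (≡.trans (≡.cong (ℤ._+_ j) (ℤ.+-inverseˡ i)) (ℤ.+-identityʳ j))))
      (cancel a b)

  ·-cancelˡ : (u v w : Monomial n) → u · v ≡ u · w → v ≡ w
  ·-cancelˡ (k , a) (l , b) (m , d) p = ≡.cong₂ _,_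
    (ℕ.+-cancelˡ-≡ k l m (≡.cong proj₁ p)) (cancel a b d (≡.cong proj₂ p))
    where
    cancel : ∀ {m} (a b d : Vec ℤ m) → Vec.zipWith ℤ._+_ a b ≡ Vec.zipWith ℤ._+_ a d → b ≡ d
    cancel []      []      []      p = ≡.refl
    cancel (i ∷ a) (j ∷ b) (k ∷ d) p = ≡.cong₂ _∷_
      (AbelianGroupProperties.∙-cancelˡ ℤ.+-0-abelianGroup i j k (≡.cong Vec.head p))
      (cancel a b d (≡.cong Vec.tail p))

  term : ℤ → Monomial n → Monomial n → ℤ
  term a u m = if does (u ≟ m) then a else ℤ.0ℤ

  coefficient-++ : (p q : Terms n) (m : Monomial n) →
    coefficient (p ++ q) m ≡ coefficient p m ℤ.+ coefficient q m
  coefficient-++ []            q m = ≡.sym (ℤ.+-identityˡ _)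
  coefficient-++ ((a , u) ∷ p) q m = ≡.trans
    (≡.cong (ℤ._+_ (term a u m)) (coefficient-++ p q m))
    (≡.sym (ℤ.+-assoc (term a u m) (coefficient p m) (coefficient q m)))

  coefficient-neg : (p : Terms n) (m : Monomial n) →
    coefficient (- p) m ≡ ℤ.- coefficient p m
  coefficient-neg []            m = ≡.refl
  coefficient-neg ((a , u) ∷ p) m = ≡.trans (≡.cong₂ ℤ._+_ (head a u) (coefficient-neg p m))
      (≡.sym (ℤ.neg-distrib-+ (term a u m) (coefficient p m)))
    where
    head : ∀ a u → term (ℤ.- a) u m ≡ ℤ.- term a u m
    head a u with u ≟ m
    ... | yes _ = ≡.refl
    ... | no  _ = ≡.refl

  -- Multiplication by a single term: `(x ∷ p) * q` is by definition `x ⊛ q ++ p * q`.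
  infixr 8 _⊛_
  _⊛_ : ℤ × Monomial n → Terms n → Terms n
  x ⊛ p = List.map (λ y → proj₁ x ℤ.* proj₁ y , proj₂ x · proj₂ y) p

  coefficient-⊛ : ∀ a u (p : Terms n) w → coefficient ((a , u) ⊛ p) (u · w) ≡ a ℤ.* coefficient p w
  coefficient-⊛ a u []            w = ≡.sym (ℤ.*-zeroʳ a)
  coefficient-⊛ a u ((b , v) ∷ p) w =
    ≡.trans (≡.cong₂ ℤ._+_ head (coefficient-⊛ a u p w))
            (≡.sym (ℤ.*-distribˡ-+ a (term b v w) (coefficient p w)))
    where
    head : term (a ℤ.* b) (u · v) (u · w) ≡ a ℤ.* term b v w
    head with u · v ≟ u · w | v ≟ w
    ... | yes _ | yes _ = ≡.refl
    ... | no  _ | no  _ = ≡.sym (ℤ.*-zeroʳ a)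
    ... | yes p | no  q = ⊥-elim (q (·-cancelˡ u v w p))
    ... | no  p | yes q = ⊥-elim (p (≡.cong (u ·_) q))

  coefficient-⊛-0 : ∀ a u (p : Terms n) m → ¬ proj₁ u ≤ proj₁ m →
    coefficient ((a , u) ⊛ p) m ≡ ℤ.0ℤ
  coefficient-⊛-0 a u []            m u≰m = ≡.refl
  coefficient-⊛-0 a u ((b , v) ∷ p) m u≰m with u · v ≟ m
  ... | yes ≡.refl = ⊥-elim (u≰m (ℕ.m≤m+n (proj₁ u) (proj₁ v)))
  ... | no  _      = ≡.trans (ℤ.+-identityˡ _) (coefficient-⊛-0 a u p m u≰m)

  open _≋_

  ≋-reflexive : {p q : Terms n} → p ≡ q → p ≋ q
  ≋-reflexive ≡.refl = mk≋ λ _ → ≡.refl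

  ≋-sym : {p q : Terms n} → p ≋ q → q ≋ p
  ≋-sym e = mk≋ λ m → ≡.sym (coefficient-≡ e m)

  ≋-trans : {p q r : Terms n} → p ≋ q → q ≋ r → p ≋ r
  ≋-trans e f = mk≋ λ m → ≡.trans (coefficient-≡ e m) (coefficient-≡ f m)

  ++-cong : {p p′ q q′ : Terms n} → p ≋ p′ → q ≋ q′ → p ++ q ≋ p′ ++ q′
  ++-cong {p} {p′} {q} {q′} e f = mk≋ λ m → begin
    coefficient (p ++ q) m                   ≡⟨ coefficient-++ p q m ⟩
    coefficient p m ℤ.+ coefficient q m      ≡⟨ ≡.cong₂ ℤ._+_ (coefficient-≡ e m) (coefficient-≡ f m) ⟩
    coefficient p′ m ℤ.+ coefficient q′ m    ≡⟨ coefficient-++ p′ q′ m ⟨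
    coefficient (p′ ++ q′) m                 ∎

  ++-comm : (p q : Terms n) → p ++ q ≋ q ++ p
  ++-comm p q = mk≋ λ m → begin
    coefficient (p ++ q) m               ≡⟨ coefficient-++ p q m ⟩
    coefficient p m ℤ.+ coefficient q m  ≡⟨ ℤ.+-comm (coefficient p m) _ ⟩
    coefficient q m ℤ.+ coefficient p m  ≡⟨ coefficient-++ q p m ⟨
    coefficient (q ++ p) m               ∎

  neg-cong : {p q : Terms n} → p ≋ q → - p ≋ - q
  neg-cong {p} {q} e = mk≋ λ m → begin
    coefficient (- p) m     ≡⟨ coefficient-neg p m ⟩
    ℤ.- coefficient p m     ≡⟨ ≡.cong ℤ.-_ (coefficient-≡ e m) ⟩
    ℤ.- coefficient q m     ≡⟨ coefficient-neg q m ⟨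
    coefficient (- q) m     ∎

  neg-inverseʳ : (p : Terms n) → p ++ - p ≋ []
  neg-inverseʳ p = mk≋ λ m → begin
    coefficient (p ++ - p) m                   ≡⟨ coefficient-++ p (- p) m ⟩
    coefficient p m ℤ.+ coefficient (- p) m    ≡⟨ ≡.cong (ℤ._+_ (coefficient p m)) (coefficient-neg p m) ⟩
    coefficient p m ℤ.+ ℤ.- coefficient p m    ≡⟨ ℤ.+-inverseʳ (coefficient p m) ⟩
    ℤ.0ℤ                                       ∎

  -- A monomial is either `u · w`, where the coefficients of `p` and `q` at `w` are scaled by `a`,
  -- or not divisible by `u`, where both products have coefficient 0. The exponent of `t` decides
  -- which.
  ⊛-cong : ∀ x {p q : Terms n} → p ≋ q → x ⊛ p ≋ x ⊛ q
  ⊛-cong (a , u) {p} {q} e = mk≋ same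
    where
    same : ∀ m → coefficient ((a , u) ⊛ p) m ≡ coefficient ((a , u) ⊛ q) m
    same m with proj₁ u ℕ.≤? proj₁ m
    ... | no u≰m = ≡.trans (coefficient-⊛-0 a u p m u≰m) (≡.sym (coefficient-⊛-0 a u q m u≰m))
    ... | yes u≤m with quotient u m u≤m
    ...   | w , ≡.refl = begin
      coefficient ((a , u) ⊛ p) (u · w)  ≡⟨ coefficient-⊛ a u p w ⟩
      a ℤ.* coefficient p w              ≡⟨ ≡.cong (a ℤ.*_) (coefficient-≡ e w) ⟩
      a ℤ.* coefficient q w              ≡⟨ coefficient-⊛ a u q w ⟨
      coefficient ((a , u) ⊛ q) (u · w)  ∎

  *-congˡ : ∀ p {q q′ : Terms n} → q ≋ q′ → p * q ≋ p * q′
  *-congˡ []      e = ≋-reflexive ≡.refl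
  *-congˡ (x ∷ p) e = ++-cong (⊛-cong x e) (*-congˡ p e)

  *-∷ : ∀ q x (p : Terms n) → q * (x ∷ p) ≋ x ⊛ q ++ q * p
  *-∷ []            x p = ≋-reflexive ≡.refl
  *-∷ ((b , v) ∷ q) (a , u) p = mk≋ λ m → ≡.cong₂ ℤ._+_
    (≡.cong₂ (λ d w → term d w m) (ℤ.*-comm b a) (·-comm v u))
    (begin
      coefficient ((b , v) ⊛ p ++ q * ((a , u) ∷ p)) m
        ≡⟨ coefficient-++ ((b , v) ⊛ p) _ m ⟩
      coefficient ((b , v) ⊛ p) m ℤ.+ coefficient (q * ((a , u) ∷ p)) m
        ≡⟨ ≡.cong (ℤ._+_ (coefficient ((b , v) ⊛ p) m))
             (≡.trans (coefficient-≡ (*-∷ q (a , u) p) m) (coefficient-++ ((a , u) ⊛ q) (q * p) m)) ⟩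
      coefficient ((b , v) ⊛ p) m ℤ.+ (coefficient ((a , u) ⊛ q) m ℤ.+ coefficient (q * p) m)
        ≡⟨ ℤ+.x∙yz≈y∙xz (coefficient ((b , v) ⊛ p) m) (coefficient ((a , u) ⊛ q) m) _ ⟩
      coefficient ((a , u) ⊛ q) m ℤ.+ (coefficient ((b , v) ⊛ p) m ℤ.+ coefficient (q * p) m)
        ≡⟨ ≡.cong (ℤ._+_ (coefficient ((a , u) ⊛ q) m)) (coefficient-++ ((b , v) ⊛ p) (q * p) m) ⟨
      coefficient ((a , u) ⊛ q) m ℤ.+ coefficient ((b , v) ⊛ p ++ q * p) m
        ≡⟨ coefficient-++ ((a , u) ⊛ q) _ m ⟨
      coefficient ((a , u) ⊛ q ++ (b , v) ⊛ p ++ q * p) m ∎)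

  *-[] : (p : Terms n) → p * [] ≡ []
  *-[] []      = ≡.refl
  *-[] (x ∷ p) = *-[] p

  *-comm : (p q : Terms n) → p * q ≋ q * p
  *-comm []      q = ≋-reflexive (≡.sym (*-[] q))
  *-comm (x ∷ p) q =
    ≋-trans (++-cong (≋-reflexive ≡.refl) (*-comm p q)) (≋-sym (*-∷ q x p))

  -- Equal left factors may be lists of different shape, so recursion on them is not possible;
  -- commutativity moves them to the right, where `*-congˡ` applies.
  *-cong : {p p′ q q′ : Terms n} → p ≋ p′ → q ≋ q′ → p * q ≋ p′ * q′
  *-cong {p} {p′} {q} {q′} e f =
    ≋-trans (*-congˡ p f) (≋-trans (*-comm p q′) (≋-trans (*-congˡ q′ e) (*-comm q′ p′)))

  *-distribʳ : (r p q : Terms n) → (p ++ q) * r ≡ p * r ++ q * r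
  *-distribʳ r []      q = ≡.refl
  *-distribʳ r (x ∷ p) q =
    ≡.trans (≡.cong (x ⊛ r ++_) (*-distribʳ r p q)) (≡.sym (List.++-assoc (x ⊛ r) (p * r) (q * r)))

  *-distribˡ : (r p q : Terms n) → r * (p ++ q) ≋ r * p ++ r * q
  *-distribˡ r p q = ≋-trans (*-comm r (p ++ q))
    (≋-trans (≋-reflexive (*-distribʳ r p q)) (++-cong (*-comm p r) (*-comm q r)))

  ⊛-⊛ : ∀ a u b v (p : Terms n) → (a ℤ.* b , u · v) ⊛ p ≡ (a , u) ⊛ (b , v) ⊛ p
  ⊛-⊛ a u b v []            = ≡.refl
  ⊛-⊛ a u b v ((d , w) ∷ p) =
    ≡.cong₂ _∷_ (≡.cong₂ _,_ (ℤ.*-assoc a b d) (·-assoc u v w)) (⊛-⊛ a u b v p)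

  ⊛-*-assoc : ∀ x (p q : Terms n) → (x ⊛ p) * q ≡ x ⊛ (p * q)
  ⊛-*-assoc x       []            q = ≡.refl
  ⊛-*-assoc (a , u) ((b , v) ∷ p) q = ≡.trans
    (≡.cong₂ _++_ (⊛-⊛ a u b v q) (⊛-*-assoc (a , u) p q))
    (≡.sym (List.map-++ _ ((b , v) ⊛ q) (p * q)))

  *-assoc : (p q r : Terms n) → (p * q) * r ≡ p * (q * r)
  *-assoc []      q r = ≡.refl
  *-assoc (x ∷ p) q r = ≡.trans (*-distribʳ r (x ⊛ q) (p * q))
    (≡.cong₂ _++_ (⊛-*-assoc x q r) (*-assoc p q r))

  *-identityˡ : (p : Terms n) → 1# * p ≡ p
  *-identityˡ p = ≡.trans (List.++-identityʳ _) (unit p)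
    where
    unit : ∀ p → (ℤ.1ℤ , ε) ⊛ p ≡ p
    unit []            = ≡.refl
    unit ((a , u) ∷ p) =
      ≡.cong₂ _∷_ (≡.cong₂ _,_ (ℤ.*-identityˡ a) (·-identityˡ u)) (unit p)

  isCommRing : IsCommRing (Laurent n)
  isCommRing = record
    { isRing = record
      { +-isAbelianGroup = record
        { isGroup = record
          { isMonoid = record
            { isSemigroup = record
              { isMagma = record
                { isEquivalence = record
                  { refl = ≋-reflexive ≡.refl ; sym = ≋-sym ; trans = ≋-trans }
                ; ∙-cong = ++-cong }
              ; assoc = λ p q r → ≋-reflexive (List.++-assoc p q r) }
            ; identity = (λ p → ≋-reflexive ≡.refl) , (λ p → ≋-reflexive (List.++-identityʳ p)) }
          ; inverse = (λ p → ≋-trans (++-comm (- p) p) (neg-inverseʳ p)) , neg-inverseʳ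
          ; ⁻¹-cong = neg-cong }
        ; comm = ++-comm }
      ; *-cong = *-cong
      ; *-assoc = λ p q r → ≋-reflexive (*-assoc p q r)
      ; *-identity = (λ p → ≋-reflexive (*-identityˡ p))
                   , (λ p → ≋-trans (*-comm p 1#) (≋-reflexive (*-identityˡ p)))
      ; distrib = *-distribˡ , (λ r p q → ≋-reflexive (*-distribʳ r p q)) }
    ; *-comm = *-comm }

  module _ (i : Fin n) where
    private
      η η̄ : Monomial n
      η = 0 , Vec.replicate n ℤ.0ℤ Vec.[ i ]≔ ℤ.1ℤ
      η̄ = 0 , Vec.replicate n ℤ.0ℤ Vec.[ i ]≔ ℤ.-1ℤ

      degree : Monomial n → ℤ
      degree (_ , a) = lookup a i

      degree-· : ∀ u v → degree (u · v) ≡ degree u ℤ.+ degree v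
      degree-· (_ , a) (_ , b) = Vec.lookup-zipWith ℤ._+_ i a b

      -- `raise k w` is `w` times the power `2k` of the variable `y i`, nested so that `invariant`
      -- can pass from `k` to `suc k` by one application of `step`.
      raise : ℕ → Monomial n → Monomial n
      raise zero    w = w
      raise (suc k) w = η · (η · raise k w)

      degree-raise : ∀ k w → degree (raise k w) ≡ ℤ.+ (k ℕ.+ k) ℤ.+ degree w
      degree-raise zero    w = ≡.sym (ℤ.+-identityˡ _)
      degree-raise (suc k) w = begin
        degree (η · (η · raise k w))
          ≡⟨ step (η · raise k w) ⟩
        ℤ.1ℤ ℤ.+ degree (η · raise k w)
          ≡⟨ ≡.cong (ℤ._+_ ℤ.1ℤ) (≡.trans (step (raise k w))
               (≡.cong (ℤ._+_ ℤ.1ℤ) (degree-raise k w))) ⟩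
        ℤ.1ℤ ℤ.+ (ℤ.1ℤ ℤ.+ (ℤ.+ (k ℕ.+ k) ℤ.+ degree w))
          ≡⟨ ≡.cong (ℤ._+_ ℤ.1ℤ) (ℤ.+-assoc ℤ.1ℤ (ℤ.+ (k ℕ.+ k)) (degree w)) ⟨
        ℤ.1ℤ ℤ.+ (ℤ.+ suc (k ℕ.+ k) ℤ.+ degree w)
          ≡⟨ ℤ.+-assoc ℤ.1ℤ (ℤ.+ suc (k ℕ.+ k)) (degree w) ⟨
        ℤ.+ suc (suc (k ℕ.+ k)) ℤ.+ degree w
          ≡⟨ ≡.cong (λ l → ℤ.+ suc l ℤ.+ degree w) (ℕ.+-suc k k) ⟨
        ℤ.+ (suc k ℕ.+ suc k) ℤ.+ degree w ∎
        where
        step : ∀ v → degree (η · v) ≡ ℤ.1ℤ ℤ.+ degree v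
        step v = ≡.trans (degree-· η v)
          (≡.cong (ℤ._+ degree v) (Vec.lookup∘update i (Vec.replicate n ℤ.0ℤ) ℤ.1ℤ))

      raise-vanishes : (p : Terms n) (w : Monomial n) →
        ∃[ K ] (∀ k → K ≤ k → coefficient p (raise k w) ≡ ℤ.0ℤ)
      raise-vanishes []            w = 0 , λ _ _ → ≡.refl
      raise-vanishes ((a , v) ∷ p) w with raise-vanishes p w
      -- The head term meets `raise k w` only if `2k` is the difference of the two degrees in `y i`;
      -- any `k` above the absolute value of that difference excludes this, since `k ≤ 2k`.
      ... | K , vanish = K ℕ.+ suc ℤ.∣ degree v ℤ.- degree w ∣ , vanish′
        where
        vanish′ : ∀ k → K ℕ.+ suc ℤ.∣ degree v ℤ.- degree w ∣ ≤ k →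
                  coefficient ((a , v) ∷ p) (raise k w) ≡ ℤ.0ℤ
        vanish′ k K≤k with v ≟ raise k w
        ... | no  _ = ≡.trans (ℤ.+-identityˡ _) (vanish k (ℕ.≤-trans (ℕ.m≤m+n K _) K≤k))
        ... | yes v≡ = ⊥-elim (ℕ.<⇒≱ (ℕ.m≤n+m (suc ℤ.∣ degree v ℤ.- degree w ∣) K)
              (ℕ.≤-trans K≤k (ℕ.≤-trans (ℕ.m≤m+n k k) (ℕ.≤-reflexive (≡.cong ℤ.∣_∣ difference)))))
          where
          difference : ℤ.+ (k ℕ.+ k) ≡ degree v ℤ.- degree w
          difference = ≡.sym (begin
            degree v ℤ.- degree w
              ≡⟨ ≡.cong (ℤ._- degree w) (≡.trans (≡.cong degree v≡) (degree-raise k w)) ⟩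
            ℤ.+ (k ℕ.+ k) ℤ.+ degree w ℤ.- degree w
              ≡⟨ ℤ.+-assoc (ℤ.+ (k ℕ.+ k)) (degree w) (ℤ.- degree w) ⟩
            ℤ.+ (k ℕ.+ k) ℤ.+ (degree w ℤ.- degree w)
              ≡⟨ ≡.cong (ℤ._+_ (ℤ.+ (k ℕ.+ k))) (ℤ.+-inverseʳ (degree w)) ⟩
            ℤ.+ (k ℕ.+ k) ℤ.+ ℤ.0ℤ
              ≡⟨ ℤ.+-identityʳ _ ⟩
            ℤ.+ (k ℕ.+ k) ∎)

    η̄·η : η̄ · η ≡ ε
    η̄·η = ≡.cong (0 ,_) (cancel i)
      where
      cancel : ∀ {m} (i : Fin m) →
        Vec.zipWith ℤ._+_ (Vec.replicate m ℤ.0ℤ Vec.[ i ]≔ ℤ.-1ℤ)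
                          (Vec.replicate m ℤ.0ℤ Vec.[ i ]≔ ℤ.1ℤ) ≡ Vec.replicate m ℤ.0ℤ
      cancel {suc m} zero    = ≡.cong (ℤ.0ℤ ∷_) (Vec.zipWith-identityˡ ℤ.+-identityˡ _)
      cancel {suc m} (suc i) = ≡.cong (ℤ.0ℤ ∷_) (cancel i)

    open Coefficients n using (y; ȳ; _-_)

    y*ȳ : y i * ȳ i ≋ 1#
    y*ȳ = ≋-reflexive (≡.cong (λ u → (ℤ.1ℤ , u) ∷ []) (≡.trans (·-comm η η̄) η̄·η))

    -- If y p = ȳ p, then the coefficients of p are invariant under multiplying
    -- monomials by y², so finiteness of p forces them to vanish.
    y-ȳ-nonZeroDivisor : ∀ p → (y i - ȳ i) * p ≋ 0# → p ≋ 0#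
    y-ȳ-nonZeroDivisor p e = mk≋ λ w →
      let K , vanish = raise-vanishes p w
      in ≡.trans (invariant K w) (vanish K ℕ.≤-refl)
      where
      back : ∀ w → η̄ · (η · (η · w)) ≡ η · w
      back w = ≡.trans (≡.sym (·-assoc η̄ η (η · w)))
        (≡.trans (≡.cong (_· (η · w)) η̄·η) (·-identityˡ (η · w)))

      -- The difference of the two sides is the coefficient of `η · w` in `(y i - ȳ i) * p`: that
      -- monomial is `η` times `w` and also `η̄` times `η · (η · w)`.
      step : ∀ w → coefficient p w ≡ coefficient p (η · (η · w))
      step w = ℤ.i-j≡0⇒i≡j _ _ (begin
        coefficient p w ℤ.- coefficient p (η · (η · w))
          ≡⟨ ≡.cong₂ ℤ._+_ (ℤ.*-identityˡ (coefficient p w)) (ℤ.-1*i≡-i _) ⟨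
        ℤ.1ℤ ℤ.* coefficient p w ℤ.+ ℤ.-1ℤ ℤ.* coefficient p (η · (η · w))
          ≡⟨ ≡.cong₂ ℤ._+_ (coefficient-⊛ ℤ.1ℤ η p w)
               (coefficient-⊛ ℤ.-1ℤ η̄ p (η · (η · w))) ⟨
        coefficient ((ℤ.1ℤ , η) ⊛ p) (η · w)
          ℤ.+ coefficient ((ℤ.-1ℤ , η̄) ⊛ p) (η̄ · (η · (η · w)))
          ≡⟨ ≡.cong (λ m → coefficient ((ℤ.1ℤ , η) ⊛ p) (η · w)
                           ℤ.+ coefficient ((ℤ.-1ℤ , η̄) ⊛ p) m) (back w) ⟩
        coefficient ((ℤ.1ℤ , η) ⊛ p) (η · w) ℤ.+ coefficient ((ℤ.-1ℤ , η̄) ⊛ p) (η · w)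
          ≡⟨ ≡.cong (λ q → coefficient ((ℤ.1ℤ , η) ⊛ p) (η · w) ℤ.+ coefficient q (η · w))
               (List.++-identityʳ ((ℤ.-1ℤ , η̄) ⊛ p)) ⟨
        coefficient ((ℤ.1ℤ , η) ⊛ p) (η · w) ℤ.+ coefficient ((ℤ.-1ℤ , η̄) ⊛ p ++ []) (η · w)
          ≡⟨ coefficient-++ ((ℤ.1ℤ , η) ⊛ p) _ (η · w) ⟨
        coefficient ((y i - ȳ i) * p) (η · w)
          ≡⟨ coefficient-≡ e (η · w) ⟩
        ℤ.0ℤ ∎)

      invariant : ∀ k w → coefficient p w ≡ coefficient p (raise k w)
      invariant zero    w = ≡.refl
      invariant (suc k) w = ≡.trans (invariant k w) (step (raise k w))

-- Power series

module PowerSeriesRing (R : RawRing c ℓ) (isCommRing : IsCommRing R) where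
  open CommRing R isCommRing
  open ≈-Reasoning

  private
    module S = RingOps (PowerSeries R)

    tail : S.Carrier → S.Carrier
    tail f k = f (suc k)

  *-congˢ : ∀ {f f′ g g′} → f S.≈ f′ → g S.≈ g′ → f S.* g S.≈ f′ S.* g′
  *-congˢ p q k = sum-cong {suc k} (λ i → *-cong (p (toℕ i)) (q (k ∸ toℕ i)))

  *-zeroˢ : ∀ {f} g → f S.≈ S.0# → f S.* g S.≈ S.0#
  *-zeroˢ g p k = trans
    (sum-cong {suc k} (λ i → trans (*-congʳ (p (toℕ i))) (zeroˡ (g (k ∸ toℕ i)))))
    (sum-replicate-zero (suc k))

  *-distribʳˢ : ∀ h f g → (f S.+ g) S.* h S.≈ f S.* h S.+ g S.* h
  *-distribʳˢ h f g k = trans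
    (sum-cong {suc k} (λ i → distribʳ (h (k ∸ toℕ i)) (f (toℕ i)) (g (toℕ i))))
    (∑-distrib-+ {suc k} (λ i → f (toℕ i) * h (k ∸ toℕ i)) (λ i → g (toℕ i) * h (k ∸ toℕ i)))

  *-scaleˢ : ∀ a f g k → ((λ l → a * f l) S.* g) k ≈ a * (f S.* g) k
  *-scaleˢ a f g k = trans
    (sum-cong {suc k} (λ i → *-assoc a (f (toℕ i)) (g (k ∸ toℕ i))))
    (sym (*-distribˡ-sum {suc k} a (λ i → f (toℕ i) * g (k ∸ toℕ i))))

  -- Both proofs below rest on the definitional equality
  -- (f * g) (suc k) = f 0 * g (suc k) + (tail f * g) k.
  *-assocˢ : ∀ f g h → (f S.* g) S.* h S.≈ f S.* (g S.* h)
  *-assocˢ f g h zero    = solve 3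
    (λ a b d → (a :* b :+ con 0) :* d :+ con 0 := a :* (b :* d :+ con 0) :+ con 0)
    refl (f 0) (g 0) (h 0)
  *-assocˢ f g h (suc k) = begin
    (f 0 * g 0 + 0#) * h (suc k) + (((λ l → f 0 * tail g l) S.+ tail f S.* g) S.* h) k
      ≈⟨ +-congˡ (trans (*-distribʳˢ h (λ l → f 0 * tail g l) (tail f S.* g) k)
           (+-cong (*-scaleˢ (f 0) (tail g) h k) (*-assocˢ (tail f) g h k))) ⟩
    (f 0 * g 0 + 0#) * h (suc k) + (f 0 * (tail g S.* h) k + (tail f S.* (g S.* h)) k)
      ≈⟨ solve 5 (λ a b d u v → (a :* b :+ con 0) :* d :+ (a :* u :+ v)
                                := a :* (b :* d :+ u) :+ v)
           refl (f 0) (g 0) (h (suc k)) ((tail g S.* h) k) ((tail f S.* (g S.* h)) k) ⟩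
    (f S.* (g S.* h)) (suc k) ∎

  -- The definition of the product splits off the first summand, this lemma the last. Commutativity
  -- matches one end with the other.
  *-snocˢ : ∀ f g k → (f S.* g) (suc k) ≈ (f S.* tail g) k + f (suc k) * g 0
  *-snocˢ f g zero    = solve 2 (λ u v → u :+ (v :+ con 0) := u :+ con 0 :+ v)
    refl (f 0 * g 1) (f 1 * g 0)
  *-snocˢ f g (suc k) = trans (+-congˡ (*-snocˢ (tail f) g k)) (sym (+-assoc _ _ _))

  *-commˢ : ∀ f g → f S.* g S.≈ g S.* f
  *-commˢ f g zero    = +-congʳ (*-comm (f 0) (g 0))
  *-commˢ f g (suc k) = begin
    f 0 * g (suc k) + (tail f S.* g) k  ≈⟨ +-comm _ _ ⟩
    (tail f S.* g) k + f 0 * g (suc k)  ≈⟨ +-cong (*-commˢ (tail f) g k) (*-comm _ _) ⟩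
    (g S.* tail f) k + g (suc k) * f 0  ≈⟨ *-snocˢ g f k ⟨
    (g S.* f) (suc k)                   ∎

  -- A series free of the outermost variable. Constants, the inner variables and their geometric
  -- series all have this shape, and multiplication by them acts on each coefficient separately.
  embed : Carrier → S.Carrier
  embed a zero    = a
  embed a (suc _) = 0#

  embed-* : ∀ a f k → (embed a S.* f) k ≈ a * f k
  embed-* a f zero    = +-identityʳ _
  embed-* a f (suc k) = trans (+-congˡ (*-zeroˢ f (λ _ → refl) k)) (+-identityʳ _)

  1#≈embed : S.1# S.≈ embed 1#
  1#≈embed zero    = refl
  1#≈embed (suc k) = refl

  *-identityˡˢ : ∀ f → S.1# S.* f S.≈ f
  *-identityˡˢ f k =
    trans (*-congˢ {g = f} 1#≈embed (λ _ → refl) k) (trans (embed-* 1# f k) (*-identityˡ _))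

  isCommRingˢ : IsCommRing (PowerSeries R)
  isCommRingˢ = record
    { isRing = record
      { +-isAbelianGroup = record
        { isGroup = record
          { isMonoid = record
            { isSemigroup = record
              { isMagma = record
                { isEquivalence = record
                  { refl = λ _ → refl
                  ; sym = λ p k → sym (p k)
                  ; trans = λ p q k → trans (p k) (q k) }
                ; ∙-cong = λ p q k → +-cong (p k) (q k) }
              ; assoc = λ f g h k → +-assoc (f k) (g k) (h k) }
            ; identity = (λ f k → +-identityˡ (f k)) , (λ f k → +-identityʳ (f k)) }
          ; inverse = (λ f k → -‿inverseˡ (f k)) , (λ f k → -‿inverseʳ (f k))
          ; ⁻¹-cong = λ p k → -‿cong (p k) }
        ; comm = λ f g k → +-comm (f k) (g k) }
      ; *-cong = *-congˢ
      ; *-assoc = *-assocˢ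
      ; *-identity = *-identityˡˢ
                   , (λ f k → trans (*-commˢ f S.1# k) (*-identityˡˢ f k))
      ; distrib = (λ h f g k → trans (*-commˢ h (f S.+ g) k) (trans (*-distribʳˢ h f g k)
                    (+-cong (*-commˢ f h k) (*-commˢ g h k))))
                , *-distribʳˢ }
    ; *-comm = *-commˢ }

  X : S.Carrier
  X zero    = 0#
  X (suc k) = S.1# k

  X-*-zero : ∀ f → (X S.* f) 0 ≈ 0#
  X-*-zero f = trans (+-identityʳ _) (zeroˡ _)

  X-*-suc : ∀ f k → (X S.* f) (suc k) ≈ f k
  X-*-suc f k = trans (+-cong (zeroˡ _) (*-identityˡˢ f k)) (+-identityˡ _)

isCommRingIn : (R : RawRing c ℓ) → IsCommRing R → ∀ n → IsCommRing (PowerSeriesIn n R)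
isCommRingIn R isCommRing zero    = isCommRing
isCommRingIn R isCommRing (suc n) =
  PowerSeriesRing.isCommRingˢ (PowerSeriesIn n R) (isCommRingIn R isCommRing n)

-- Series in several variables: coefficients, order of vanishing, division by differences of
-- variables

<-∸⇒+-< : ∀ k m {a} → a < m ∸ k → k ℕ.+ a < m
<-∸⇒+-< zero    m       p = p
<-∸⇒+-< (suc k) (suc m) p = s≤s (<-∸⇒+-< k m p)

+-<⇒<-∸ : ∀ k m {a} → k ℕ.+ a < m → a < m ∸ k
+-<⇒<-∸ zero    m       p       = p
+-<⇒<-∸ (suc k) (suc m) (s≤s p) = +-<⇒<-∸ k m p

suc-∸-≤ : ∀ m k → suc m ∸ k ≤ suc (m ∸ k)
suc-∸-≤ m       zero    = ℕ.≤-refl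
suc-∸-≤ zero    (suc k) = ℕ.≤-trans (ℕ.m∸n≤m 0 k) z≤n
suc-∸-≤ (suc m) (suc k) = suc-∸-≤ m k

module MultivariateSeries (R : RawRing c ℓ) (isCommRing : IsCommRing R) where
  private
    module R = CommRing R isCommRing

  module S (n : ℕ) = CommRing (PowerSeriesIn n R) (isCommRingIn R isCommRing n)
  module E (n : ℕ) = PowerSeriesRing (PowerSeriesIn n R) (isCommRingIn R isCommRing n)

  coeff-cong : ∀ n {f g} → S._≈_ n f g → ∀ α → coeff R {n} f α R.≈ coeff R {n} g α
  coeff-cong zero    p []      = p
  coeff-cong (suc n) p (k ∷ α) = coeff-cong n (p k) α

  coeff-ext : ∀ n {f g} → (∀ α → coeff R {n} f α R.≈ coeff R {n} g α) → S._≈_ n f g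
  coeff-ext zero    p   = p []
  coeff-ext (suc n) p k = coeff-ext n (λ α → p (k ∷ α))

  coeff-+ : ∀ n f g α → coeff R {n} (S._+_ n f g) α R.≈ coeff R {n} f α R.+ coeff R {n} g α
  coeff-+ zero    f g []      = R.refl
  coeff-+ (suc n) f g (k ∷ α) = coeff-+ n (f k) (g k) α

  coeff-neg : ∀ n f α → coeff R {n} (S.-_ n f) α R.≈ R.- coeff R {n} f α
  coeff-neg zero    f []      = R.refl
  coeff-neg (suc n) f (k ∷ α) = coeff-neg n (f k) α

  coeff-0 : ∀ n α → coeff R {n} (S.0# n) α R.≈ R.0#
  coeff-0 zero    []      = R.refl
  coeff-0 (suc n) (k ∷ α) = coeff-0 n α

  fromCoeff : ∀ n → (Vec ℕ n → R.Carrier) → Series R n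
  fromCoeff zero    φ   = φ []
  fromCoeff (suc n) φ k = fromCoeff n (λ α → φ (k ∷ α))

  coeff-fromCoeff : ∀ n φ α → coeff R {n} (fromCoeff n φ) α ≡ φ α
  coeff-fromCoeff zero    φ []      = ≡.refl
  coeff-fromCoeff (suc n) φ (k ∷ α) = coeff-fromCoeff n (λ α → φ (k ∷ α)) α

  module _ (n : ℕ) where
    open S n

    const-embed : ∀ a → S._≈_ (suc n) (const R (suc n) a) (E.embed n (const R n a))
    const-embed a zero    = refl
    const-embed a (suc k) = refl

    var-embed : ∀ i → S._≈_ (suc n) (var R {suc n} (suc i)) (E.embed n (var R {n} i))
    var-embed i zero    = refl
    var-embed i (suc k) = refl

    geometric-embed : ∀ i a → S._≈_ (suc n) (geometric R {suc n} (suc i) a) (E.embed n (geometric R {n} i a))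
    geometric-embed i a zero    = refl
    geometric-embed i a (suc k) = refl

    var-X : S._≈_ (suc n) (var R {suc n} zero) (E.X n)
    var-X zero          = refl
    var-X (suc zero)    = refl
    var-X (suc (suc k)) = refl

    ≈embed⇒* : ∀ {f} a g → S._≈_ (suc n) f (E.embed n a) → ∀ k →
               S._*_ (suc n) f g k ≈ a * g k
    ≈embed⇒* a g p k =
      trans (E.*-congˢ n {g = g} p (λ _ → refl) k) (E.embed-* n a g k)

  const-*-coeff : ∀ n a f α → coeff R {n} (S._*_ n (const R n a) f) α R.≈ a R.* coeff R {n} f α
  const-*-coeff zero    a f []      = R.refl
  const-*-coeff (suc n) a f (k ∷ α) = R.trans
    (coeff-cong n (≈embed⇒* n (const R n a) f (const-embed n a) k) α)
    (const-*-coeff n a (f k) α)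

  const-cong : ∀ n {a b} → a R.≈ b → S._≈_ n (const R n a) (const R n b)
  const-cong zero    p         = p
  const-cong (suc n) p zero    = const-cong n p
  const-cong (suc n) p (suc k) = S.refl n

  const-0 : ∀ n → S._≈_ n (const R n R.0#) (S.0# n)
  const-0 zero            = R.refl
  const-0 (suc n) zero    = const-0 n
  const-0 (suc n) (suc k) = S.refl n

  const-1 : ∀ n → S._≈_ n (const R n R.1#) (S.1# n)
  const-1 zero            = R.refl
  const-1 (suc n) zero    = const-1 n
  const-1 (suc n) (suc k) = S.refl n

  const-+ : ∀ n a b → S._≈_ n (const R n (a R.+ b)) (S._+_ n (const R n a) (const R n b))
  const-+ zero    a b         = R.refl
  const-+ (suc n) a b zero    = const-+ n a b
  const-+ (suc n) a b (suc k) = S.sym n (S.+-identityˡ n (S.0# n))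

  const-neg : ∀ n a → S._≈_ n (const R n (R.- a)) (S.-_ n (const R n a))
  const-neg zero    a         = R.refl
  const-neg (suc n) a zero    = const-neg n a
  const-neg (suc n) a (suc k) = S.sym n (S.-0#≈0# n)

  const-* : ∀ n a b → S._≈_ n (const R n (a R.* b)) (S._*_ n (const R n a) (const R n b))
  const-* n a b = coeff-ext n (λ α → R.sym (R.trans (const-*-coeff n a (const R n b) α) (scaled n α)))
    where
    scaled : ∀ n α → a R.* coeff R {n} (const R n b) α R.≈ coeff R {n} (const R n (a R.* b)) α
    scaled zero    []          = R.refl
    scaled (suc n) (zero ∷ α)  = scaled n α
    scaled (suc n) (suc k ∷ α) =
      R.trans (R.*-congˡ (coeff-0 n α)) (R.trans (R.zeroʳ a) (R.sym (coeff-0 n α)))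

  module Const (n : ℕ) =
    Related R (PowerSeriesIn n R) (λ a f → S._≈_ n (const R n a) f)
      (const-0 n) (const-1 n)
      (λ p q → S.trans n (const-+ n _ _) (S.+-cong n p q))
      (λ p q → S.trans n (const-* n _ _) (S.*-cong n p q))
      (λ p → S.trans n (const-neg n _) (S.-‿cong n p))

  -- For the outermost variable, coefficient `k + 1` of the product is `a ^ (k + 1) - a * a ^ k`,
  -- and only the constant term survives. For an inner variable both factors are free of the
  -- outermost one, and the claim passes to the ring of coefficients.
  geometric-inverse : ∀ n (i : Fin n) a → S._≈_ n
    (S._*_ n (S._-_ n (S.1# n) (S._*_ n (const R n a) (var R {n} i))) (geometric R {n} i a)) (S.1# n)
  geometric-inverse (suc n) zero a k = begin
    ((S′.1# S′.- C S′.* x) S′.* G) k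
      ≈⟨ S′.distribʳ G S′.1# (S′.- (C S′.* x)) k ⟩
    (S′.1# S′.* G) k + ((S′.- (C S′.* x)) S′.* G) k
      ≈⟨ +-cong (S′.*-identityˡ G k) (S′.trans (S′.sym (S′.-‿distribˡ-* (C S′.* x) G))
           (S′.-‿cong (S′.*-assoc C x G)) k) ⟩
    G k - (C S′.* (x S′.* G)) k
      ≈⟨ +-congˡ (-‿cong (≈embed⇒* n (const R n a) (x S′.* G) (const-embed n a) k)) ⟩
    G k - const R n a * (x S′.* G) k
      ≈⟨ telescope k ⟩
    S′.1# k ∎
    where
    module S′ = S (suc n)
    open S n
    open S.≈-Reasoning n
    C x G : S′.Carrier
    C = const R (suc n) a
    x = var R {suc n} zero
    G = geometric R {suc n} zero a

    xG≈XG : x S′.* G S′.≈ E.X n S′.* G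
    xG≈XG = S′.*-congʳ {G} {x} {E.X n} (var-X n)

    telescope : ∀ k → G k - const R n a * (x S′.* G) k ≈ S′.1# k
    telescope zero = trans
      (+-cong (const-1 n) (-‿cong (trans (*-congˡ (trans (xG≈XG 0) (E.X-*-zero n G))) (zeroʳ _))))
      (trans (+-congˡ -0#≈0#) (+-identityʳ _))
    telescope (suc k) = trans
      (+-cong (const-* n a _) (-‿cong (*-congˡ (trans (xG≈XG (suc k)) (E.X-*-suc n G k)))))
      (-‿inverseʳ _)
  geometric-inverse (suc n) (suc i) a k = trans
    (≈embed⇒* n (1# - const R n a * var R {n} i) (geometric R {suc n} (suc i) a) factor k)
    (trans (*-congˡ (geometric-embed n i a k)) (at k))
    where
    module S′ = S (suc n)
    open S n

    factor : S′.1# S′.- const R (suc n) a S′.* var R {suc n} (suc i) S′.≈ E.embed n (1# - const R n a * var R {n} i)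
    factor zero = +-congˡ (-‿cong (≈embed⇒* n (const R n a) (var R {suc n} (suc i)) (const-embed n a) 0))
    factor (suc k) = trans (+-identityˡ _) (trans
      (-‿cong (trans (≈embed⇒* n (const R n a) (var R {suc n} (suc i)) (const-embed n a) (suc k)) (zeroʳ _)))
      -0#≈0#)

    at : ∀ k → (1# - const R n a * var R {n} i) * E.embed n (geometric R {n} i a) k ≈ S′.1# k
    at zero    = geometric-inverse n i a
    at (suc k) = zeroʳ _

  -- Membership in the `m`-th power of the ideal generated by the variables, read off from the
  -- coefficients.
  Vanishes : ∀ n → ℕ → Series R n → Set ℓ
  Vanishes n m f = ∀ α → Vec.sum α < m → coeff R {n} f α R.≈ R.0#

  -- The exponent `k` of the outermost variable accounts for `k` of the total degree. For `k ≥ m`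
  -- truncated subtraction gives 0, and the condition is empty.
  slice : ∀ n m f → Vanishes (suc n) m f → ∀ k → Vanishes n (m ∸ k) (f k)
  slice n m f v k α p = v (k ∷ α) (<-∸⇒+-< k m p)

  unslice : ∀ n m f → (∀ k → Vanishes n (m ∸ k) (f k)) → Vanishes (suc n) m f
  unslice n m f v (k ∷ α) p = v k α (+-<⇒<-∸ k m p)

  module _ (n : ℕ) where
    private
      module T = S n

    vanishes-all : ∀ f → (∀ m → Vanishes n m f) → f T.≈ T.0#
    vanishes-all f v = coeff-ext n λ α → R.trans (v _ α ℕ.≤-refl) (R.sym (coeff-0 n α))

    vanishes-cong : ∀ {m f g} → f T.≈ g → Vanishes n m f → Vanishes n m g
    vanishes-cong p v α q = R.trans (R.sym (coeff-cong n p α)) (v α q)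

    vanishes-≤ : ∀ {m m′ f} → m′ ≤ m → Vanishes n m f → Vanishes n m′ f
    vanishes-≤ m′≤m v α q = v α (ℕ.≤-trans q m′≤m)

    vanishes-0 : ∀ {m} → Vanishes n m T.0#
    vanishes-0 α _ = coeff-0 n α

    vanishes-zero : ∀ f → Vanishes n 0 f
    vanishes-zero f α ()

    vanishes-+ : ∀ {m} f g → Vanishes n m f → Vanishes n m g → Vanishes n m (f T.+ g)
    vanishes-+ f g v w α q =
      R.trans (coeff-+ n f g α) (R.trans (R.+-cong (v α q) (w α q)) (R.+-identityˡ _))

    vanishes-neg : ∀ {m} f → Vanishes n m f → Vanishes n m (T.- f)
    vanishes-neg f v α q =
      R.trans (coeff-neg n f α) (R.trans (R.-‿cong (v α q)) R.-0#≈0#)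

    vanishes-sum : ∀ {m k} (f : Fin k → T.Carrier) →
      (∀ i → Vanishes n m (f i)) → Vanishes n m (T.sum f)
    vanishes-sum {k = zero}  f v = vanishes-0
    vanishes-sum {k = suc k} f v =
      vanishes-+ (f zero) (T.sum (f ∘ suc)) (v zero) (vanishes-sum (f ∘ suc) (v ∘ suc))

  -- Coefficient `k` of the product involves `f` only at indices at most `k`, where it vanishes at
  -- least to order `m ∸ k`.
  vanishes-* : ∀ n {m} g f → Vanishes n m f → Vanishes n m (S._*_ n g f)
  vanishes-* zero    g f v [] q = R.trans (R.*-congˡ (v [] q)) (R.zeroʳ g)
  vanishes-* (suc n) {m} g f v = unslice n m _ λ k →
    vanishes-sum n {k = suc k} (λ i → S._*_ n (g (toℕ i)) (f (k ∸ toℕ i))) λ i →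
      vanishes-* n (g (toℕ i)) (f (k ∸ toℕ i))
        (vanishes-≤ n (ℕ.∸-monoʳ-≤ m (ℕ.m∸n≤m k (toℕ i))) (slice n m f v (k ∸ toℕ i)))

  vanishes-var-* : ∀ n (i : Fin n) {m} f → Vanishes n m f → Vanishes n (suc m) (S._*_ n (var R {n} i) f)
  vanishes-var-* (suc n) zero    {m} f v = unslice n (suc m) _ λ where
      zero    → vanishes-cong n (S.sym n (S.trans n (xf≈Xf 0) (E.X-*-zero n f))) (vanishes-0 n)
      (suc k) → vanishes-cong n (S.sym n (S.trans n (xf≈Xf (suc k)) (E.X-*-suc n f k)))
                  (slice n m f v k)
    where
    module S′ = S (suc n)
    xf≈Xf : var R {suc n} zero S′.* f S′.≈ E.X n S′.* f
    xf≈Xf = S′.*-congʳ {f} {var R {suc n} zero} {E.X n} (var-X n)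
  vanishes-var-* (suc n) (suc i) {m} f v = unslice n (suc m) _ λ k →
    vanishes-cong n (S.sym n (≈embed⇒* n (var R {n} i) f (var-embed n i) k))
      (vanishes-≤ n (suc-∸-≤ m k) (vanishes-var-* n i (f k) (slice n m f v k)))

  vanishes-var-^ : ∀ n (i : Fin n) l → Vanishes n l (S._^_ n (var R {n} i) l)
  vanishes-var-^ n i zero    = vanishes-zero n _
  vanishes-var-^ n i (suc l) = vanishes-var-* n i _ (vanishes-var-^ n i l)

  -- Expanded along column zero, every term has an entry of that column as a factor. For a partition
  -- this column carries the largest exponents.
  vanishes-det : ∀ n {k m} (M : Fin (suc k) → Fin (suc k) → Series R n) →
    (∀ i → Vanishes n m (M i zero)) → Vanishes n m (S.det n M)
  vanishes-det n M v = vanishes-cong n (S.sym n (Determinants.det-column _ (isCommRingIn R isCommRing n) M))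
    (vanishes-sum n (λ i → sign i * M i zero * minor i) λ i →
      vanishes-cong n (S.*-comm n (minor i) (sign i * M i zero))
        (vanishes-* n (minor i) (sign i * M i zero) (vanishes-* n (sign i) (M i zero) (v i))))
    where
    open S n using (_*_)
    open Determinants _ (isCommRingIn R isCommRing n) using (sign)
    minor : Fin _ → Series R n
    minor i = S.det n (λ k j → M (punchIn i k) (suc j))

  -- Since the parts already decrease, the chain starting with `b` can fail only at its first link,
  -- so the first part exceeds `b`, and with it the exponent in column zero. The map `v` separates
  -- the number of rows from the number of variables, so that the partition can be analysed by
  -- cases.
  vanishes-schurNumerator : ∀ n {k} (v : Fin k → Fin n) (μ : Partition k) b →
    ¬ Linked _≥_ (b ∷ Partition.parts μ) →
    Vanishes n (suc b) (S.det n (λ i j → S._^_ n (var R {n} (v i)) (shifted μ j)))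
  vanishes-schurNumerator n v (partition [] _)      b unbounded = ⊥-elim (unbounded [-])
  vanishes-schurNumerator n {suc k} v μ@(partition (h ∷ p) d) b unbounded =
    vanishes-det n (λ i j → S._^_ n (var R {n} (v i)) (shifted μ j)) λ i → vanishes-≤ n
      (ℕ.≤-trans (ℕ.≰⇒> (λ h≤b → unbounded (h≤b ∷ d))) (ℕ.m≤m+n h k))
      (vanishes-var-^ n (v i) (h ℕ.+ k))

  module Congruence (n m : ℕ) where
    open S n

    infix 4 _∼_
    _∼_ : Carrier → Carrier → Set _
    f ∼ g = Vanishes n m (f - g)

    private
      telescope : ∀ a b d → (a - b) + (b - d) ≈ a - d
      telescope a b d = trans
        (solve 4 (λ a b′ b d′ → a :+ b′ :+ (b :+ d′) := a :+ d′ :+ (b :+ b′)) refl a (- b) b (- d))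
        (trans (+-congˡ (-‿inverseʳ b)) (+-identityʳ _))

    ∼-reflexive : ∀ {f g} → f ≈ g → f ∼ g
    ∼-reflexive {f} {g} p =
      vanishes-cong n (sym (trans (+-congʳ p) (-‿inverseʳ g))) (vanishes-0 n)

    vanishes⇒∼0 : ∀ {f} → Vanishes n m f → f ∼ 0#
    vanishes⇒∼0 {f} = vanishes-cong n (sym (trans (+-congˡ -0#≈0#) (+-identityʳ f)))

    ∼-sym : ∀ {f g} → f ∼ g → g ∼ f
    ∼-sym {f} {g} p = vanishes-cong n
      (trans (sym (-‿+-comm f (- g))) (trans (+-congˡ (-‿involutive g)) (+-comm (- f) g)))
      (vanishes-neg n (f - g) p)

    ∼-trans : ∀ {f g h} → f ∼ g → g ∼ h → f ∼ h
    ∼-trans {f} {g} {h} p q =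
      vanishes-cong n (telescope f g h) (vanishes-+ n (f - g) (g - h) p q)

    +-cong-∼ : ∀ {f f′ g g′} → f ∼ f′ → g ∼ g′ → f + g ∼ f′ + g′
    +-cong-∼ {f} {f′} {g} {g′} p q = vanishes-cong n
      (trans (solve 4 (λ f a g b → f :+ a :+ (g :+ b) := f :+ g :+ (a :+ b)) refl f (- f′) g (- g′))
        (+-congˡ (-‿+-comm f′ g′)))
      (vanishes-+ n (f - f′) (g - g′) p q)

    *-cong-∼ : ∀ {f f′ g g′} → f ∼ f′ → g ∼ g′ → f * g ∼ f′ * g′
    *-cong-∼ {f} {f′} {g} {g′} p q = vanishes-cong n
      (trans (+-cong (x[y-z]≈xy-xz f g g′) (trans (*-comm g′ (f - f′)) ([y-z]x≈yx-zx g′ f f′)))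
        (telescope (f * g) (f * g′) (f′ * g′)))
      (vanishes-+ n (f * (g - g′)) (g′ * (f - f′))
        (vanishes-* n f (g - g′) q) (vanishes-* n g′ (f - f′) p))

    neg-cong-∼ : ∀ {f f′} → f ∼ f′ → - f ∼ - f′
    neg-cong-∼ {f} {f′} p = vanishes-cong n (sym (-‿+-comm f (- f′))) (vanishes-neg n (f - f′) p)

    open Related (PowerSeriesIn n R) (PowerSeriesIn n R) _∼_
      (∼-reflexive refl) (∼-reflexive refl) +-cong-∼ *-cong-∼ neg-cong-∼ public
      using () renaming (det~ to det-cong-∼)

  const-nonZeroDivisor : ∀ n {a} → (∀ b → a R.* b R.≈ R.0# → b R.≈ R.0#) →
    ∀ f → S._≈_ n (S._*_ n (const R n a) f) (S.0# n) → S._≈_ n f (S.0# n)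
  const-nonZeroDivisor n {a} cancel f p = coeff-ext n λ α → R.trans
    (cancel _ (R.trans (R.sym (const-*-coeff n a f α)) (R.trans (coeff-cong n p α) (coeff-0 n α))))
    (R.sym (coeff-0 n α))

  -- Dividing by g costs at most d in the order of vanishing.
  Regular : ∀ n → ℕ → Series R n → Set _
  Regular n d g = ∀ m f → Vanishes n (d ℕ.+ m) (S._*_ n g f) → Vanishes n m f

  regular-1 : ∀ n → Regular n 0 (S.1# n)
  regular-1 n m f = vanishes-cong n (S.*-identityˡ n f)

  regular-* : ∀ n {d e} g h → Regular n d g → Regular n e h → Regular n (d ℕ.+ e) (S._*_ n g h)
  regular-* n {d} {e} g h p q m f v = q m f (p (e ℕ.+ m) (S._*_ n h f)
    (vanishes-cong n (S.*-assoc n g h f)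
      (vanishes-≤ n (ℕ.≤-reflexive (≡.sym (ℕ.+-assoc d e m))) v)))

  regular-product : ∀ n {k} (f : Fin k → Series R n) →
    (∀ i → ∃[ d ] Regular n d (f i)) → ∃[ d ] Regular n d (S.product n f)
  regular-product n {zero}  f p = 0 , regular-1 n
  regular-product n {suc k} f p with p zero | regular-product n (f ∘ suc) (p ∘ suc)
  ... | d , q | e , r = d ℕ.+ e , regular-* n (f zero) (S.product n (f ∘ suc)) q r

  regular-product< : ∀ n {k} (f : Fin k → Fin k → Series R n) →
    (∀ i j → toℕ i < toℕ j → ∃[ d ] Regular n d (f i j)) → ∃[ d ] Regular n d (S.product< n f)
  regular-product< n {zero}  f p = 0 , regular-1 n
  regular-product< n {suc k} f p
    with regular-product n (λ j → f zero (suc j)) (λ j → p zero (suc j) (s≤s z≤n))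
       | regular-product< n (λ i j → f (suc i) (suc j)) (λ i j i<j → p (suc i) (suc j) (s≤s i<j))
  ... | d , q | e , r = d ℕ.+ e ,
    regular-* n (S.product n (λ j → f zero (suc j))) (S.product< n (λ i j → f (suc i) (suc j))) q r

  -- If `i` is the outermost variable, the product with `f` has coefficient
  -- `f k - var j * f (suc k)` at `suc k`. So `f k` is, up to a term of sufficient order,
  -- `var j * f (suc k)`, and going on to larger `k` each step gains one in the order; hence the
  -- recursion on the desired order `d`. If neither variable is outermost, the difference acts on
  -- each coefficient separately.
  regular-var-var : ∀ n (i j : Fin n) → toℕ i < toℕ j → Regular n 1 (S._-_ n (var R {n} i) (var R {n} j))
  regular-var-var (suc n) zero (suc j) _ m f v = unslice n m f λ k → descend k (m ∸ k) ℕ.≤-refl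
    where
    module S′ = S (suc n)
    open S n
    x y : S′.Carrier
    x = var R {suc n} zero
    y = var R {suc n} (suc j)

    step : ∀ k → ((x S′.- y) S′.* f) (suc k) ≈ f k - var R {n} j * f (suc k)
    step k = trans (S′.distribʳ f x (S′.- y) (suc k)) (+-cong
      (trans (S′.*-congʳ {f} {x} {E.X n} (var-X n) (suc k)) (E.X-*-suc n f k))
      (trans (sym (S′.-‿distribˡ-* y f (suc k)))
        (-‿cong (≈embed⇒* n (var R {n} j) f (var-embed n j) (suc k)))))

    restore : ∀ a b → (a - b) + b ≈ a
    restore a b = trans (+-assoc a (- b) b) (trans (+-congˡ (-‿inverseˡ b)) (+-identityʳ a))

    descend : ∀ k d → d ≤ m ∸ k → Vanishes n d (f k)
    descend k zero    _  = vanishes-zero n (f k)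
    descend k (suc d) d< = vanishes-cong n (restore (f k) (var R {n} j * f (suc k)))
      (vanishes-+ n (f k - var R {n} j * f (suc k)) (var R {n} j * f (suc k))
        (vanishes-cong n (step k) (vanishes-≤ n d< (slice n (suc m) _ v (suc k))))
        (vanishes-var-* n j (f (suc k)) (descend (suc k) d
          (ℕ.≤-trans (ℕ.pred-mono-≤ d<) (ℕ.≤-reflexive (ℕ.pred[m∸n]≡m∸[1+n] m k))))))
  regular-var-var (suc n) (suc i) (suc j) (s≤s i<j) m f v = unslice n m f at
    where
    module S′ = S (suc n)
    open S n

    factor : var R {suc n} (suc i) S′.- var R {suc n} (suc j) S′.≈ E.embed n (var R {n} i - var R {n} j)
    factor zero    = refl
    factor (suc k) = -‿inverseʳ _

    at : ∀ k → Vanishes n (m ∸ k) (f k)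
    -- `suc m ∸ k` equals `suc (m ∸ k)` only for `k ≤ m`; for larger `k` the required order is 0.
    at k with k ℕ.≤? m
    ... | yes k≤m = regular-var-var n i j i<j (m ∸ k) (f k)
          (vanishes-cong n (≈embed⇒* n (var R {n} i - var R {n} j) f factor k)
            (vanishes-≤ n (ℕ.≤-reflexive (≡.sym (ℕ.+-∸-assoc 1 k≤m))) (slice n (suc m) _ v k)))
    ... | no  k≰m = vanishes-≤ n
          (ℕ.≤-reflexive (ℕ.m≤n⇒m∸n≡0 (ℕ.<⇒≤ (ℕ.≰⇒> k≰m)))) (vanishes-zero n (f k))

-- The kernel

module CauchyKernel (R : RawRing c ℓ) (isCommRing : IsCommRing R) where
  open CommRing R isCommRing
  open FiniteSums R isCommRing using (sumBelow)
  open ≈-Reasoning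

  ^-distrib-* : ∀ a b k → (a * b) ^ k ≈ a ^ k * b ^ k
  ^-distrib-* a b zero    = sym (*-identityˡ 1#)
  ^-distrib-* a b (suc k) = trans (*-congˡ (^-distrib-* a b k))
    (solve 4 (λ a b p q → a :* b :* (p :* q) := a :* p :* (b :* q)) refl a b (a ^ k) (b ^ k))

  -≈+-1* : ∀ a b → a - b ≈ a + - 1# * b
  -≈+-1* a b = +-congˡ (sym (-1*x≈-x b))

  a+b-b≈a : ∀ a b → (a + b) - b ≈ a
  a+b-b≈a a b = trans (+-assoc a b (- b)) (trans (+-congˡ (-‿inverseʳ b)) (+-identityʳ a))

  a-b+b≈a : ∀ a b → (a - b) + b ≈ a
  a-b+b≈a a b = trans (+-assoc a (- b) b) (trans (+-congˡ (-‿inverseˡ b)) (+-identityʳ a))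

  -- Adding a common `k` to both terms turns a claim about differences into two equations without
  -- subtraction, which the semiring solver can treat.
  -‿shift : ∀ {a b k a′ b′} → a + k ≈ a′ → b + k ≈ b′ → a - b ≈ a′ - b′
  -‿shift {a} {b} {k} {a′} {b′} p q = begin
    a - b                ≈⟨ +-cong (a+b-b≈a a k) (-‿cong (a+b-b≈a b k)) ⟨
    (a + k - k) - (b + k - k)
      ≈⟨ trans (+-congˡ (sym (-‿+-comm _ _)))
           (solve 4 (λ a k b k′ → a :+ k :+ (b :+ k′) := a :+ b :+ (k :+ k′)) refl
              (a + k) (- k) (- (b + k)) (- (- k))) ⟩
    (a + k) - (b + k) + (- k - - k)
      ≈⟨ trans (+-congˡ (-‿inverseʳ (- k))) (+-identityʳ _) ⟩
    (a + k) - (b + k)    ≈⟨ +-cong p (-‿cong q) ⟩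
    a′ - b′              ∎

  unfold-inverse : ∀ {p u} → (1# - p) * u ≈ 1# → u ≈ 1# + p * u
  unfold-inverse {p} {u} inv = begin
    u                       ≈⟨ a-b+b≈a u (p * u) ⟨
    u - p * u + p * u       ≈⟨ +-congʳ (+-congʳ (*-identityˡ u)) ⟨
    1# * u - p * u + p * u  ≈⟨ +-congʳ ([y-z]x≈yx-zx u 1# p) ⟨
    (1# - p) * u + p * u    ≈⟨ +-congʳ inv ⟩
    1# + p * u              ∎

  complement-* : ∀ p q → (1# - p) * (1# - q) + (p + q) ≈ 1# + p * q
  complement-* p q = begin
    (1# - p) * (1# - q) + (p + q)
      ≈⟨ solve 4 (λ p q p′ q′ → (con 1 :+ p′) :* (con 1 :+ q′) :+ (p :+ q)
                             := con 1 :+ p′ :* q′ :+ (p :+ p′) :+ (q :+ q′))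
           refl p q (- p) (- q) ⟩
    1# + - p * - q + (p - p) + (q - q)
      ≈⟨ +-cong (trans (+-congˡ (-‿inverseʳ p)) (+-identityʳ _)) (-‿inverseʳ q) ⟩
    1# + - p * - q + 0#
      ≈⟨ trans (+-identityʳ _) (+-congˡ (trans (sym (-‿distribˡ-* p (- q)))
           (trans (-‿cong (sym (-‿distribʳ-* p q))) (-‿involutive _)))) ⟩
    1# + p * q ∎

  -- Over the common denominator the numerator is `a (1 - b X) - b (1 - a X)`, in which `a b X`
  -- cancels; this is the `k` passed to `-‿shift`.
  geometric-difference : ∀ {a b X u v} → (1# - a * X) * u ≈ 1# → (1# - b * X) * v ≈ 1# →
    a * u - b * v ≈ (a - b) * (u * v)
  geometric-difference {a} {b} {X} {u} {v} p q = trans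
    (-‿shift {k = a * b * X * (u * v)}
      (trans (solve 5 (λ a b x u v → a :* u :+ a :* b :* x :* (u :* v)
                                     := a :* (u :* (con 1 :+ b :* x :* v))) refl a b X u v)
             (*-congˡ (*-congˡ (sym (unfold-inverse q)))))
      (trans (solve 5 (λ a b x u v → b :* v :+ a :* b :* x :* (u :* v)
                                     := b :* ((con 1 :+ a :* x :* u) :* v)) refl a b X u v)
             (*-congˡ (*-congʳ (sym (unfold-inverse p))))))
    (sym ([y-z]x≈yx-zx (u * v) a b))

  module _ {X T Y Z : Carrier} (YZ≈1 : Y * Z ≈ 1#) where

    -- The terms linear in `X`, collected in `K`, occur equally in both products and cancel. By
    -- `Y * Z = 1` the rest is `1 + T² X² - T - T X²`, which factors.
    numerator : (1# - T * Y * X) * (1# - T * Z * X) - T * ((1# - Y * X) * (1# - Z * X))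
                ≈ (1# - T * X ^ 2) * (1# - T)
    numerator = begin
      A - TB                ≈⟨ -‿shift refl refl ⟩
      (A + K) - (TB + K)    ≈⟨ +-congʳ A+K ⟩
      (C + (TB + K)) - (TB + K)  ≈⟨ a+b-b≈a C (TB + K) ⟩
      C ∎
      where
      A B TB C K : Carrier
      A = (1# - T * Y * X) * (1# - T * Z * X)
      B = (1# - Y * X) * (1# - Z * X)
      TB = T * B
      C = (1# - T * X ^ 2) * (1# - T)
      K = T * Y * X + T * Z * X

      A+K : A + K ≈ C + (TB + K)
      A+K = begin
        A + K
          ≈⟨ complement-* (T * Y * X) (T * Z * X) ⟩
        1# + T * Y * X * (T * Z * X)
          ≈⟨ +-congˡ (trans (solve 4 (λ t y z x → t :* y :* x :* (t :* z :* x)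
                := (y :* z) :* (t :* (x :* (x :* con 1)) :* t)) refl T Y Z X)
               (trans (*-congʳ YZ≈1) (*-identityˡ _))) ⟩
        1# + T * X ^ 2 * T
          ≈⟨ complement-* (T * X ^ 2) T ⟨
        C + (T * X ^ 2 + T)
          ≈⟨ +-congˡ (trans (solve 2 (λ t x → t :* (x :* (x :* con 1)) :+ t
                := t :* (con 1 :+ con 1 :* (x :* x))) refl T X)
               (*-congˡ (+-congˡ (trans (*-congʳ (sym YZ≈1))
                 (solve 3 (λ y z x → y :* z :* (x :* x) := y :* x :* (z :* x)) refl Y Z X))))) ⟩
        C + T * (1# + Y * X * (Z * X))
          ≈⟨ +-congˡ (*-congˡ (complement-* (Y * X) (Z * X))) ⟨
        C + T * (B + (Y * X + Z * X))
          ≈⟨ +-congˡ (solve 5 (λ t b y z x → t :* (b :+ (y :* x :+ z :* x))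
                := t :* b :+ (t :* y :* x :+ t :* z :* x)) refl T B Y Z X) ⟩
        C + (TB + K) ∎

    -- `Y` is paired with `Z` for each power of `T` first: both differences then contain `Y - Z`,
    -- and the remaining combination of `G₁ * G₃` and `G₂ * G₄` has `numerator` over the common
    -- denominator.
    kernel-sum : ∀ {G₁ G₂ G₃ G₄} →
      (1# - Y * X) * G₁ ≈ 1# → (1# - T * Y * X) * G₂ ≈ 1# →
      (1# - Z * X) * G₃ ≈ 1# → (1# - T * Z * X) * G₄ ≈ 1# →
      (Y * G₁ - Z * G₃) - (T * Y * G₂ - T * Z * G₄)
        ≈ (1# - T * X ^ 2) * ((Y - Z) * ((1# - T) * G₁ * G₂ * G₃ * G₄))
    kernel-sum {G₁} {G₂} {G₃} {G₄} i₁ i₂ i₃ i₄ = begin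
      (Y * G₁ - Z * G₃) - (T * Y * G₂ - T * Z * G₄)
        ≈⟨ +-cong (geometric-difference i₁ i₃) (-‿cong (geometric-difference i₂ i₄)) ⟩
      (Y - Z) * (G₁ * G₃) - (T * Y - T * Z) * (G₂ * G₄)
        ≈⟨ +-congˡ (-‿cong (trans (*-congʳ (sym (x[y-z]≈xy-xz T Y Z)))
             (solve 3 (λ t d g → t :* d :* g := d :* (t :* g)) refl T (Y - Z) (G₂ * G₄)))) ⟩
      (Y - Z) * (G₁ * G₃) - (Y - Z) * (T * (G₂ * G₄))
        ≈⟨ x[y-z]≈xy-xz (Y - Z) _ _ ⟨
      (Y - Z) * (G₁ * G₃ - T * (G₂ * G₄))
        ≈⟨ *-congˡ (+-cong G₁G₃ (-‿cong TG₂G₄)) ⟩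
      (Y - Z) * (A * Π - T * B * Π)
        ≈⟨ *-congˡ (trans (sym ([y-z]x≈yx-zx Π A (T * B))) (*-congʳ numerator)) ⟩
      (Y - Z) * ((1# - T * X ^ 2) * (1# - T) * Π)
        ≈⟨ solve 7 (λ d r s a b e f → d :* (r :* s :* (a :* b :* e :* f))
                                     := r :* (d :* (s :* a :* b :* e :* f)))
             refl (Y - Z) (1# - T * X ^ 2) (1# - T) G₁ G₂ G₃ G₄ ⟩
      (1# - T * X ^ 2) * ((Y - Z) * ((1# - T) * G₁ * G₂ * G₃ * G₄)) ∎
      where
      A B Π : Carrier
      A = (1# - T * Y * X) * (1# - T * Z * X)
      B = (1# - Y * X) * (1# - Z * X)
      Π = G₁ * G₂ * G₃ * G₄

      insert : ∀ {p q u v} w → p * u ≈ 1# → q * v ≈ 1# → w ≈ p * u * (q * v) * w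
      insert w i j = sym (trans (*-congʳ (trans (*-cong i j) (*-identityˡ 1#))) (*-identityˡ w))

      G₁G₃ : G₁ * G₃ ≈ A * Π
      G₁G₃ = trans (insert (G₁ * G₃) i₂ i₄)
        (solve 6 (λ p q a b e f → p :* b :* (q :* f) :* (a :* e) := p :* q :* (a :* b :* e :* f))
          refl (1# - T * Y * X) (1# - T * Z * X) G₁ G₂ G₃ G₄)

      TG₂G₄ : T * (G₂ * G₄) ≈ T * B * Π
      TG₂G₄ = trans (*-congˡ (insert (G₂ * G₄) i₁ i₃))
        (solve 7 (λ t p q a b e f → t :* (p :* a :* (q :* e) :* (b :* f))
                                    := t :* (p :* q) :* (a :* b :* e :* f))
          refl T (1# - Y * X) (1# - Z * X) G₁ G₂ G₃ G₄)

  powers : ℕ → Carrier → Carrier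
  powers m a = sumBelow m (a ^_)

  powers-remainder : ∀ m a → (1# - a) * powers m a + a ^ m ≈ 1#
  powers-remainder zero    a = trans (+-congʳ (zeroʳ _)) (+-identityˡ 1#)
  powers-remainder (suc m) a = begin
    (1# - a) * (powers m a + a ^ m) + a * a ^ m
      ≈⟨ solve 4 (λ r s p a → r :* (s :+ p) :+ a :* p := r :* s :+ (r :+ a) :* p)
           refl (1# - a) (powers m a) (a ^ m) a ⟩
    (1# - a) * powers m a + (1# - a + a) * a ^ m
      ≈⟨ +-congˡ (trans (*-congʳ (a-b+b≈a 1# a)) (*-identityˡ _)) ⟩
    (1# - a) * powers m a + a ^ m
      ≈⟨ powers-remainder m a ⟩
    1# ∎

  -- The error is a multiple of `a ^ m`, hence of order at least `m` when `a` is a multiple of a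
  -- variable.
  inverse-truncation : ∀ m {a u} → (1# - a) * u ≈ 1# → u ≈ powers m a + u * a ^ m
  inverse-truncation m {a} {u} inv = begin
    u                                            ≈⟨ *-identityʳ u ⟨
    u * 1#                                       ≈⟨ *-congˡ (powers-remainder m a) ⟨
    u * ((1# - a) * powers m a + a ^ m)
      ≈⟨ solve 4 (λ u r s p → u :* (r :* s :+ p) := r :* u :* s :+ u :* p)
           refl u (1# - a) (powers m a) (a ^ m) ⟩
    (1# - a) * u * powers m a + u * a ^ m        ≈⟨ +-congʳ (trans (*-congʳ inv) (*-identityˡ _)) ⟩
    powers m a + u * a ^ m                       ∎

  kernel-truncation : ∀ m X T Y Z →
    sumBelow m (λ l → X ^ l * ((1# - T ^ suc l) * (Y ^ suc l - Z ^ suc l)))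
      ≈ (Y * powers m (Y * X) - Z * powers m (Z * X))
        - (T * Y * powers m (T * Y * X) - T * Z * powers m (T * Z * X))
  kernel-truncation m X T Y Z = trans (signed m) (sym (trans (-≈+-1* _ _)
      (+-cong (-≈+-1* _ _) (*-congˡ (-≈+-1* _ _)))))
    where
    e : Carrier
    e = - 1#

    -- With `- 1#` as an indeterminate `e`, the induction step is an equality of polynomials with
    -- natural coefficients.
    signed : ∀ m → sumBelow m (λ l → X ^ l * ((1# - T ^ suc l) * (Y ^ suc l - Z ^ suc l)))
      ≈ (Y * powers m (Y * X) + e * (Z * powers m (Z * X)))
        + e * (T * Y * powers m (T * Y * X) + e * (T * Z * powers m (T * Z * X)))
    signed zero    = solve 4
      (λ e t y z → con 0 := y :* con 0 :+ e :* (z :* con 0)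
                            :+ e :* (t :* y :* con 0 :+ e :* (t :* z :* con 0)))
      refl e T Y Z
    signed (suc m) = trans
      (+-cong (signed m) (*-congˡ (*-cong (-≈+-1* _ _) (-≈+-1* _ _))))
      (trans
        (solve 12 (λ e t y z x p q r a b f g →
            y :* a :+ e :* (z :* b) :+ e :* (t :* y :* f :+ e :* (t :* z :* g))
              :+ x :* ((con 1 :+ e :* (t :* p)) :* (y :* q :+ e :* (z :* r)))
            := y :* (a :+ q :* x) :+ e :* (z :* (b :+ r :* x))
               :+ e :* (t :* y :* (f :+ p :* q :* x) :+ e :* (t :* z :* (g :+ p :* r :* x))))
          refl e T Y Z (X ^ m) (T ^ m) (Y ^ m) (Z ^ m)
          (powers m (Y * X)) (powers m (Z * X)) (powers m (T * Y * X)) (powers m (T * Z * X)))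
        (sym (+-cong
          (+-cong (*-congˡ (+-congˡ (^-distrib-* Y X m)))
                  (*-congˡ (*-congˡ (+-congˡ (^-distrib-* Z X m)))))
          (*-congˡ (+-cong
            (*-congˡ (+-congˡ (^-distrib-*₃ T Y X m)))
            (*-congˡ (*-congˡ (+-congˡ (^-distrib-*₃ T Z X m)))))))))
      where
      ^-distrib-*₃ : ∀ a b d k → (a * b * d) ^ k ≈ a ^ k * b ^ k * d ^ k
      ^-distrib-*₃ a b d k =
        trans (^-distrib-* (a * b) d k) (*-congʳ (^-distrib-* a b k))

-- Partitions

-- Placing the bound in front of the parts expresses bound and decrease by one chain, also when
-- there are no parts.
BoundedPartition : ℕ → ℕ → Set
BoundedPartition n b = Σ (Vec ℕ n) (λ v → Linked _≥_ (b ∷ v))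

BoundedPartition-≡ : ∀ {n b} {p q : BoundedPartition n b} → proj₁ p ≡ proj₁ q → p ≡ q
BoundedPartition-≡ {p = v , k} {.v , l} ≡.refl = ≡.cong (v ,_) (Linked.irrelevant ℕ.≤-irrelevant k l)

prepend : ∀ {n} b → BoundedPartition n b → BoundedPartition (suc n) b
prepend b (v , l) = b ∷ v , ℕ.≤-refl ∷ l

relax : ∀ {n b} → BoundedPartition (suc n) b → BoundedPartition (suc n) (suc b)
relax (v , h ∷ l) = v , ℕ.m≤n⇒m≤1+n h ∷ l

relax-proj₁ : ∀ {n b} (p : BoundedPartition (suc n) b) → proj₁ (relax p) ≡ proj₁ p
relax-proj₁ (v , h ∷ l) = ≡.refl

-- The cases, first part equal to the bound or smaller, come in the order used by
-- `strictlyDecreasing`; thus `map-staircase` is an equality of lists and not merely a permutation.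
boundedPartitions : ∀ n b → List (BoundedPartition n b)
boundedPartitions zero    b       = ([] , [-]) ∷ []
boundedPartitions (suc n) zero    = List.map (prepend 0) (boundedPartitions n 0)
boundedPartitions (suc n) (suc b) =
  List.map (prepend (suc b)) (boundedPartitions n (suc b))
    ++ List.map relax (boundedPartitions (suc n) b)

boundedPartitions-complete : ∀ n b (p : BoundedPartition n b) → p ∈ boundedPartitions n b
boundedPartitions-complete zero    b       ([] , [-])        = here ≡.refl
boundedPartitions-complete (suc n) zero    (zero ∷ v , h ∷ l) =
  ≡.subst (_∈ boundedPartitions (suc n) 0) (BoundedPartition-≡ ≡.refl)
    (∈-map⁺ (prepend 0) (boundedPartitions-complete n 0 (v , l)))
boundedPartitions-complete (suc n) (suc b) (a ∷ v , h ∷ l) with a ℕ.≟ suc b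
... | yes ≡.refl = ≡.subst (_∈ boundedPartitions (suc n) (suc b)) (BoundedPartition-≡ ≡.refl)
        (∈-++⁺ˡ (∈-map⁺ (prepend (suc b)) (boundedPartitions-complete n (suc b) (v , l))))
... | no  a≢ = ≡.subst (_∈ boundedPartitions (suc n) (suc b)) (BoundedPartition-≡ ≡.refl)
        (∈-++⁺ʳ _ (∈-map⁺ relax (boundedPartitions-complete (suc n) b
          (a ∷ v , ℕ.≤-pred (ℕ.≤∧≢⇒< h a≢) ∷ l))))

boundedPartitions-unique : ∀ n b → Unique (boundedPartitions n b)
boundedPartitions-unique zero    b       = All.[] ∷ []
boundedPartitions-unique (suc n) zero    =
  Unique.map⁺ (λ e → BoundedPartition-≡ (≡.cong (Vec.tail ∘ proj₁) e))
    (boundedPartitions-unique n 0)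
boundedPartitions-unique (suc n) (suc b) = Unique.++⁺
  (Unique.map⁺ (λ e → BoundedPartition-≡ (≡.cong (Vec.tail ∘ proj₁) e))
    (boundedPartitions-unique n (suc b)))
  (Unique.map⁺ (λ {p} {q} e → BoundedPartition-≡
      (≡.trans (≡.sym (relax-proj₁ p)) (≡.trans (≡.cong proj₁ e) (relax-proj₁ q))))
    (boundedPartitions-unique (suc n) b))
  λ (p∈ , q∈) → disjoint (∈-map⁻ (prepend (suc b)) p∈) (∈-map⁻ relax q∈)
  where
  disjoint : ∀ {r} → (∃[ p ] p ∈ boundedPartitions n (suc b) × r ≡ prepend (suc b) p) →
             ¬ (∃[ q ] q ∈ boundedPartitions (suc n) b × r ≡ relax q)
  disjoint (p , _ , ≡.refl) (q@(_ , h ∷ _) , _ , e) = ℕ.1+n≰n (ℕ.≤-trans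
    (ℕ.≤-reflexive (≡.cong (Vec.head ∘ proj₁) e)) h)

toPartition : ∀ {n b} → BoundedPartition n b → Partition n
toPartition (v , l) = partition v (Linked.tail l)

toPartition-relax : ∀ {n b} (p : BoundedPartition (suc n) b) →
  toPartition (relax p) ≡ toPartition p
toPartition-relax (v , h ∷ l) = ≡.refl

partitionsUpTo : ∀ n → ℕ → List (Partition n)
partitionsUpTo n b = List.map toPartition (boundedPartitions n b)

partitionsUpTo-unique : ∀ n b → Unique (partitionsUpTo n b)
partitionsUpTo-unique n b =
  Unique.map⁺ (λ e → BoundedPartition-≡ (≡.cong Partition.parts e)) (boundedPartitions-unique n b)

∉partitionsUpTo : ∀ {n b} μ → μ ∉ partitionsUpTo n b → ¬ Linked _≥_ (b ∷ Partition.parts μ)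
∉partitionsUpTo {n} {b} (partition v d) μ∉ l = μ∉ (≡.subst (_∈ partitionsUpTo n b)
  (≡.cong (partition v) (Linked.irrelevant ℕ.≤-irrelevant _ _))
  (∈-map⁺ toPartition (boundedPartitions-complete n b (v , l))))

-- Adds `(n - 1, …, 1, 0)`, which turns weakly decreasing vectors into strictly decreasing ones and
-- gives the exponents `shifted`.
staircase : ∀ {n} → Vec ℕ n → Vec ℕ n
staircase         []      = []
staircase {suc n} (a ∷ v) = (a ℕ.+ n) ∷ staircase v

lookup-staircase : ∀ {n} (v : Vec ℕ n) j →
  lookup (staircase v) j ≡ lookup v j ℕ.+ (n ∸ suc (toℕ j))
lookup-staircase (a ∷ v) zero    = ≡.refl
lookup-staircase (a ∷ v) (suc j) = lookup-staircase v j

strictlyDecreasing-empty : ∀ n m → m < n → strictlyDecreasing n m ≡ []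
strictlyDecreasing-empty (suc n) zero    _         = ≡.refl
strictlyDecreasing-empty (suc n) (suc m) (s≤s m<n) = ≡.cong₂ (λ p q → List.map (m ∷_) p ++ q)
  (strictlyDecreasing-empty n m m<n) (strictlyDecreasing-empty (suc n) m (ℕ.m<n⇒m<1+n m<n))

map-staircase : ∀ n b →
  List.map (staircase ∘ proj₁) (boundedPartitions n b) ≡ strictlyDecreasing n (b ℕ.+ n)
map-staircase zero    b       = ≡.refl
map-staircase (suc n) zero    = begin
  List.map (staircase ∘ proj₁) (List.map (prepend 0) (boundedPartitions n 0))
    ≡⟨ List.map-∘ (boundedPartitions n 0) ⟨
  List.map ((n ∷_) ∘ (staircase ∘ proj₁)) (boundedPartitions n 0)
    ≡⟨ List.map-∘ (boundedPartitions n 0) ⟩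
  List.map (n ∷_) (List.map (staircase ∘ proj₁) (boundedPartitions n 0))
    ≡⟨ ≡.cong (List.map (n ∷_)) (map-staircase n 0) ⟩
  List.map (n ∷_) (strictlyDecreasing n n)
    -- With bound 0 the first part must be 0. The other half of `strictlyDecreasing` asks for
    -- `suc n` distinct numbers below `n` and is empty.
    ≡⟨ List.++-identityʳ _ ⟨
  List.map (n ∷_) (strictlyDecreasing n n) ++ []
    ≡⟨ ≡.cong (List.map (n ∷_) (strictlyDecreasing n n) ++_)
         (strictlyDecreasing-empty (suc n) n ℕ.≤-refl) ⟨
  strictlyDecreasing (suc n) (suc n) ∎
  where open ≡.≡-Reasoning
map-staircase (suc n) (suc b) = begin
  List.map f (List.map (prepend (suc b)) P ++ List.map relax Q)
    ≡⟨ List.map-++ f (List.map (prepend (suc b)) P) (List.map relax Q) ⟩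
  List.map f (List.map (prepend (suc b)) P) ++ List.map f (List.map relax Q)
    ≡⟨ ≡.cong₂ _++_ (≡.trans (≡.sym (List.map-∘ P)) (List.map-∘ P))
         (≡.trans (≡.sym (List.map-∘ Q)) (List.map-cong (λ q → ≡.cong staircase (relax-proj₁ q)) Q)) ⟩
  List.map ((suc b ℕ.+ n) ∷_) (List.map (staircase ∘ proj₁) P) ++ List.map f′ Q
    ≡⟨ ≡.cong₂ _++_ (≡.cong (List.map ((suc b ℕ.+ n) ∷_)) (map-staircase n (suc b)))
         (map-staircase (suc n) b) ⟩
  List.map ((suc b ℕ.+ n) ∷_) (strictlyDecreasing n (suc b ℕ.+ n))
    ++ strictlyDecreasing (suc n) (b ℕ.+ suc n)
    ≡⟨ ≡.cong (λ m → List.map (m ∷_) (strictlyDecreasing n m)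
                     ++ strictlyDecreasing (suc n) (b ℕ.+ suc n)) (ℕ.+-suc b n) ⟨
  strictlyDecreasing (suc n) (suc (b ℕ.+ suc n)) ∎
  where
  open ≡.≡-Reasoning
  P : List (BoundedPartition n (suc b))
  P = boundedPartitions n (suc b)
  Q : List (BoundedPartition (suc n) b)
  Q = boundedPartitions (suc n) b
  f : BoundedPartition (suc n) (suc b) → Vec ℕ (suc n)
  f = staircase ∘ proj₁
  f′ : BoundedPartition (suc n) b → Vec ℕ (suc n)
  f′ = staircase ∘ proj₁

module StableSums (R : RawRing c ℓ) (isCommRing : IsCommRing R) where
  open CommRing R isCommRing
  open FiniteSums R isCommRing
  open ≈-Reasoning

  -- The partitions gained have first part `suc b`, where `g` vanishes; without parts the bound has
  -- no effect.
  Σ-partitionsUpTo-suc : ∀ n b (g : Partition n → Carrier) →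
    (∀ μ → ¬ Linked _≥_ (b ∷ Partition.parts μ) → g μ ≈ 0#) →
    Σ[ partitionsUpTo n (suc b) ] g ≈ Σ[ partitionsUpTo n b ] g
  Σ-partitionsUpTo-suc zero    b g vanish = refl
  Σ-partitionsUpTo-suc (suc n) b g vanish = begin
    Σ[ List.map toPartition (List.map (prepend (suc b)) P ++ List.map relax Q) ] g
      ≈⟨ trans (Σ-map toPartition (List.map (prepend (suc b)) P ++ List.map relax Q) g)
           (Σ-++ (List.map (prepend (suc b)) P) (List.map relax Q) (g ∘ toPartition)) ⟩
    Σ[ List.map (prepend (suc b)) P ] (g ∘ toPartition) + Σ[ List.map relax Q ] (g ∘ toPartition)
      ≈⟨ +-cong
           (trans (Σ-map (prepend (suc b)) P (g ∘ toPartition))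
             (Σ-zero P (λ p → vanish _ (λ l → ℕ.1+n≰n (Linked.head l)))))
           (trans (Σ-map relax Q (g ∘ toPartition))
             (trans (Σ-cong Q (λ q → reflexive (≡.cong g (toPartition-relax q))))
               (sym (Σ-map toPartition Q g)))) ⟩
    0# + Σ[ partitionsUpTo (suc n) b ] g
      ≈⟨ +-identityˡ _ ⟩
    Σ[ partitionsUpTo (suc n) b ] g ∎
    where
    P : List (BoundedPartition n (suc b))
    P = boundedPartitions n (suc b)
    Q : List (BoundedPartition (suc n) b)
    Q = boundedPartitions (suc n) b

  Σ-partitionsUpTo-≤ : ∀ n d b (g : Partition n → Carrier) →
    (∀ μ → ¬ Linked _≥_ (b ∷ Partition.parts μ) → g μ ≈ 0#) →
    Σ[ partitionsUpTo n (d ℕ.+ b) ] g ≈ Σ[ partitionsUpTo n b ] g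
  Σ-partitionsUpTo-≤ n zero    b g vanish = refl
  Σ-partitionsUpTo-≤ n (suc d) b g vanish = trans
    (Σ-partitionsUpTo-suc n (d ℕ.+ b) g (λ μ unbounded → vanish μ (unbounded ∘ widen)))
    (Σ-partitionsUpTo-≤ n d b g vanish)
    where
    widen : ∀ {m} {v : Vec ℕ m} → Linked _≥_ (b ∷ v) → Linked _≥_ ((d ℕ.+ b) ∷ v)
    widen [-]     = [-]
    widen (h ∷ l) = ℕ.≤-trans h (ℕ.m≤n+m b d) ∷ l

-- The identity

module _ (R : RawRing c ℓ) (isCommRing : IsCommRing R) where
  open CommRing R isCommRing
  open FiniteSums R isCommRing

  sumBelow-cong : ∀ m {f g : ℕ → Carrier} → (∀ l → f l ≈ g l) → sumBelow m f ≈ sumBelow m g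
  sumBelow-cong zero    p = refl
  sumBelow-cong (suc m) p = +-cong (sumBelow-cong m p) (p m)

  product-* : ∀ {n} (f g : Fin n → Carrier) →
    product (λ i → f i * g i) ≈ product f * product g
  product-* f g = MonoidSum.∑-distrib-+ *-commutativeMonoid f g

  product<-* : ∀ {n} (f g : Fin n → Fin n → Carrier) →
    product< (λ i j → f i j * g i j) ≈ product< f * product< g
  product<-* {zero}  f g = sym (*-identityˡ 1#)
  product<-* {suc n} f g = trans
    (*-cong (product-* (λ j → f zero (suc j)) (λ j → g zero (suc j)))
            (product<-* (λ i j → f (suc i) (suc j)) (λ i j → g (suc i) (suc j))))
    (solve 4 (λ a b p q → a :* b :* (p :* q) := a :* p :* (b :* q)) refl _ _ _ _)

  product-nonZeroDivisor : ∀ {n} (f : Fin n → Carrier) →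
    (∀ i a → f i * a ≈ 0# → a ≈ 0#) → ∀ a → product f * a ≈ 0# → a ≈ 0#
  product-nonZeroDivisor {zero}  f cancel a p = trans (sym (*-identityˡ a)) p
  product-nonZeroDivisor {suc n} f cancel a p =
    product-nonZeroDivisor (f ∘ suc) (cancel ∘ suc) a
      (cancel zero _ (trans (sym (*-assoc (f zero) (product (f ∘ suc)) a)) p))

module Identity (n : ℕ) where
  open Coefficients n using (t; y; ȳ; weight; IsSymplecticCharacter)
  open FormalSeries n using (ι; x; 1/[1-_·x_]; IsSchurPolynomial)

  private
    isCommRingᴬ : IsCommRing (Laurent n)
    isCommRingᴬ = LaurentRing.isCommRing n

    isCommRingˢ : IsCommRing (PowerSeriesIn n (Laurent n))
    isCommRingˢ = isCommRingIn (Laurent n) isCommRingᴬ n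

    module A where
      open CommRing (Laurent n) isCommRingᴬ public
      open FiniteSums (Laurent n) isCommRingᴬ public

  open CommRing (PowerSeriesIn n (Laurent n)) isCommRingˢ
  open FiniteSums (PowerSeriesIn n (Laurent n)) isCommRingˢ
  open CauchyKernel (PowerSeriesIn n (Laurent n)) isCommRingˢ
  open MultivariateSeries (Laurent n) isCommRingᴬ hiding (module S; module E)

  Δˣ : Carrier
  Δˣ = product< (λ i j → x i - x j)

  Δʸ Y V : A.Carrier
  Δʸ = A.product< (λ i j → y i A.- y j)
  Y  = A.product< (λ i j → A.1# A.- ȳ i A.* ȳ j)
  V  = A.product (λ i → y i A.- ȳ i)

  factor : Fin n → Carrier
  factor i = 1# - ι t * x i ^ 2

  kernel : Fin n → Fin n → Carrier
  kernel i j = ι (A.1# A.- t) * 1/[1- y j ·x i ] * 1/[1- t A.* y j ·x i ]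
                              * 1/[1- ȳ j ·x i ] * 1/[1- t A.* ȳ j ·x i ]

  -- An entry of the symplectic numerator together with the factor of `weight` for the same part.
  -- The index `l` is the exponent of `x` in the Schur numerator, one less than that of `y`.
  column : Fin n → ℕ → A.Carrier
  column j l = (A.1# A.- t A.^ suc l) A.* (y j A.^ suc l A.- ȳ j A.^ suc l)

  ι-‿ : ∀ a b → ι (a A.- b) ≈ ι a - ι b
  ι-‿ a b = trans (const-+ n a (A.- b)) (+-congˡ (const-neg n b))

  ι-^ : ∀ a k → ι (a A.^ k) ≈ ι a ^ k
  ι-^ a k = Const.^~ n {x = a} k refl

  ι-column : ∀ j l → ι (column j l)
    ≈ (1# - ι t ^ suc l) * (ι (y j) ^ suc l - ι (ȳ j) ^ suc l)
  ι-column j l = trans (const-* n (A.1# A.- t A.^ suc l) (y j A.^ suc l A.- ȳ j A.^ suc l)) (*-cong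
    (trans (ι-‿ A.1# (t A.^ suc l)) (+-cong (const-1 n) (-‿cong (ι-^ t (suc l)))))
    (trans (ι-‿ (y j A.^ suc l) (ȳ j A.^ suc l))
      (+-cong (ι-^ (y j) (suc l)) (-‿cong (ι-^ (ȳ j) (suc l))))))

  -- `M` is the number of columns kept and `m` the order up to which the entries are determined; the
  -- remainders are multiples of `x i ^ M`.
  module _ (m M : ℕ) (m≤M : m ≤ M) where
    open Congruence n m

    geometric-inverse′ : ∀ i {a b} → ι a ≈ b → (1# - b * x i) * 1/[1- a ·x i ] ≈ 1#
    geometric-inverse′ i {a} p =
      trans (*-congʳ (+-congˡ (-‿cong (*-congʳ (sym p))))) (geometric-inverse n i a)

    powers∼geometric : ∀ i {a} b → ι a ≈ b → powers M (b * x i) ∼ 1/[1- a ·x i ]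
    powers∼geometric i {a} b p = ∼-trans (∼-reflexive (sym (+-identityʳ P)))
      (∼-trans (+-cong-∼ (∼-reflexive (refl {P})) (∼-sym (vanishes⇒∼0 remainder)))
        (∼-reflexive (sym (inverse-truncation M {b * x i} {G} (geometric-inverse′ i p)))))
      where
      P G : Carrier
      P = powers M (b * x i)
      G = 1/[1- a ·x i ]

      remainder : Vanishes n m (G * (b * x i) ^ M)
      remainder = vanishes-cong n
        (trans (*-assoc G (b ^ M) (x i ^ M)) (*-congˡ (sym (^-distrib-* b (x i) M))))
        (vanishes-* n (G * b ^ M) (x i ^ M) (vanishes-≤ n m≤M (vanishes-var-^ n i M)))

    entry : ∀ i j → sumBelow M (λ l → x i ^ l * ι (column j l))
                    ∼ factor i * (ι (y j A.- ȳ j) * kernel i j)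
    entry i j = ∼-trans
      (∼-reflexive (trans
        (sumBelow-cong _ isCommRingˢ M (λ l → *-congˡ (ι-column j l)))
        (kernel-truncation M (x i) T (ι (y j)) (ι (ȳ j)))))
      (∼-trans
        (+-cong-∼
          (+-cong-∼ (scale (ι (y j)) (powers∼geometric i _ refl))
                    (neg-cong-∼ (scale (ι (ȳ j)) (powers∼geometric i _ refl))))
          (neg-cong-∼
            (+-cong-∼ (scale (T * ι (y j)) (powers∼geometric i _ (const-* n t (y j))))
              (neg-cong-∼ (scale (T * ι (ȳ j)) (powers∼geometric i _ (const-* n t (ȳ j))))))))
        (∼-reflexive (trans
          (kernel-sum YZ≈1 (geometric-inverse′ i refl) (geometric-inverse′ i (const-* n t (y j)))
                           (geometric-inverse′ i refl) (geometric-inverse′ i (const-* n t (ȳ j))))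
          (*-congˡ (*-cong (sym (ι-‿ (y j) (ȳ j)))
            (*-congʳ (*-congʳ (*-congʳ (*-congʳ
              (sym (trans (ι-‿ A.1# t) (+-congʳ (const-1 n)))))))))))))
      where
      T : Carrier
      T = ι t

      scale : ∀ b {f g} → f ∼ g → b * f ∼ b * g
      scale b = *-cong-∼ (∼-reflexive (refl {b}))

      YZ≈1 : ι (y j) * ι (ȳ j) ≈ 1#
      YZ≈1 = trans (sym (const-* n (y j) (ȳ j)))
        (trans (const-cong n (LaurentRing.y*ȳ n j)) (const-1 n))

    truncated-det : det (λ i j → sumBelow M (λ l → x i ^ l * ι (column j l)))
                    ∼ (product factor * det kernel) * ι V
    truncated-det = ∼-trans (det-cong-∼ entry) (∼-reflexive (begin
      det (λ i j → factor i * (ι (y j A.- ȳ j) * kernel i j))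
        ≈⟨ det-scaleRows _ isCommRingˢ factor (λ i j → ι (y j A.- ȳ j) * kernel i j) ⟩
      product factor * det (λ i j → ι (y j A.- ȳ j) * kernel i j)
        ≈⟨ *-congˡ (det-scaleColumns _ isCommRingˢ (λ j → ι (y j A.- ȳ j)) kernel) ⟩
      product factor * (product (λ j → ι (y j A.- ȳ j)) * det kernel)
        ≈⟨ *-congˡ (trans (*-congʳ (sym (Const.product~ n {f = λ j → y j A.- ȳ j} (λ j → refl)))) (*-comm _ _)) ⟩
      product factor * (det kernel * ι V)
        ≈⟨ *-assoc _ _ _ ⟨
      (product factor * det kernel) * ι V ∎))
      where open ≈-Reasoning

  module _
    (s : Partition n → Carrier) (s-schur : ∀ μ → IsSchurPolynomial μ (s μ))
    (sp : Partition n → A.Carrier) (sp-symplectic : ∀ μ → IsSymplecticCharacter μ (sp μ))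
    where

    D : Carrier
    D = Δˣ * ι Δʸ * ι Y

    summand : Partition n → Carrier
    summand μ = ι (weight μ) * s μ * ι (sp μ)

    alternant : Vec ℕ n → Carrier
    alternant l = det (λ i j → x i ^ lookup l j) * det (λ i j → ι (column i (lookup l j)))

    -- `s μ` takes up `Δˣ`, `sp μ` takes up `V`, `Δʸ` and `Y`, and `weight μ` scales the columns of
    -- the symplectic numerator.
    summand-* : ∀ μ → (D * ι V) * summand μ ≈ alternant (staircase (Partition.parts μ))
    summand-* μ = begin
      (Δˣ * ι Δʸ * ι Y * ι V) * (ι (weight μ) * s μ * ι (sp μ))
        ≈⟨ solve 7 (λ a b d v w s p → (a :* b :* d :* v) :* (w :* s :* p)
                                      := (s :* a) :* (w :* (p :* (v :* (b :* d)))))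
             refl Δˣ (ι Δʸ) (ι Y) (ι V) (ι (weight μ)) (s μ) (ι (sp μ)) ⟩
      (s μ * Δˣ) * (ι (weight μ) * (ι (sp μ) * (ι V * (ι Δʸ * ι Y))))
        ≈⟨ *-cong (s-schur μ) (sym (trans (const-* n (weight μ) _) (*-congˡ (trans (const-* n (sp μ) _)
             (*-congˡ (trans (const-* n V _) (*-congˡ (const-* n Δʸ Y)))))))) ⟩
      det (λ i j → x i ^ shifted μ j) * ι (weight μ A.* (sp μ A.* (V A.* (Δʸ A.* Y))))
        ≈⟨ *-congˡ (trans (const-cong n numerator-A) (Const.det~ n {f = λ i j → column i (shifted μ j)} (λ i j → refl))) ⟩
      det (λ i j → x i ^ shifted μ j) * det (λ i j → ι (column i (shifted μ j)))
        ≈⟨ *-cong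
             (det-cong (λ i j → reflexive (≡.cong (x i ^_) (≡.sym (lookup-staircase parts j)))))
             (det-cong (λ i j → reflexive (≡.cong (ι ∘ column i) (≡.sym (lookup-staircase parts j))))) ⟩
      alternant (staircase parts) ∎
      where
      open ≈-Reasoning
      parts : Vec ℕ n
      parts = Partition.parts μ

      numerator-A : weight μ A.* (sp μ A.* (V A.* (Δʸ A.* Y)))
                    A.≈ A.det (λ i j → column i (shifted μ j))
      numerator-A = A.trans
        (A.*-congˡ {weight μ} (A.trans
          (A.*-congˡ {sp μ} (A.*-congˡ {V} (A.sym (product<-* _ isCommRingᴬ
            (λ i j → y i A.- y j) (λ i j → A.1# A.- ȳ i A.* ȳ j)))))
          (sp-symplectic μ)))
        (A.sym (det-scaleColumns _ isCommRingᴬ (λ j → A.1# A.- t A.^ suc (shifted μ j))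
          (λ i j → y i A.^ suc (shifted μ j) A.- ȳ i A.^ suc (shifted μ j))))

    -- A first part at most `b` means a largest exponent at most `b + n - 1`, so the column sets run
    -- over the exponents below `b + n`.
    finite-identity : ∀ b → (D * ι V) * Σ[ partitionsUpTo n b ] summand
      ≈ det (λ i j → sumBelow (b ℕ.+ n) (λ l → x i ^ l * ι (column j l)))
    finite-identity b = begin
      (D * ι V) * Σ[ partitionsUpTo n b ] summand
        ≈⟨ Σ-distribˡ (partitionsUpTo n b) (D * ι V) summand ⟨
      Σ[ partitionsUpTo n b ] (λ μ → (D * ι V) * summand μ)
        ≈⟨ Σ-cong (partitionsUpTo n b) summand-* ⟩
      Σ[ partitionsUpTo n b ] (λ μ → alternant (staircase (Partition.parts μ)))
        ≈⟨ Σ-map toPartition (boundedPartitions n b) _ ⟩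
      Σ[ boundedPartitions n b ] (λ p → alternant (staircase (proj₁ p)))
        ≈⟨ Σ-map (staircase ∘ proj₁) (boundedPartitions n b) alternant ⟨
      Σ[ List.map (staircase ∘ proj₁) (boundedPartitions n b) ] alternant
        ≈⟨ reflexive (≡.cong (λ ls → Σ[ ls ] alternant) (map-staircase n b)) ⟩
      Σ[ strictlyDecreasing n (b ℕ.+ n) ] alternant
        ≈⟨ cauchy-binet _ isCommRingˢ n (b ℕ.+ n) (λ i l → x i ^ l) (λ j l → ι (column j l)) ⟩
      det (λ i j → sumBelow (b ℕ.+ n) (λ l → x i ^ l * ι (column j l))) ∎
      where open ≈-Reasoning

    private
      Δˣ-regular : ∃[ d ] Regular n d Δˣ
      Δˣ-regular = regular-product< n (λ i j → x i - x j)
        (λ i j i<j → 1 , regular-var-var n i j i<j)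

      d : ℕ
      d = proj₁ Δˣ-regular

    -- The Schur numerator has order at least `m + d + 1`, and division by `Δˣ` loses at most `d`,
    -- one for each pair `i < j`.
    summand-vanishes : ∀ m μ → ¬ Linked _≥_ ((m ℕ.+ d) ∷ Partition.parts μ) →
                       Vanishes n (suc m) (summand μ)
    summand-vanishes m μ unbounded = vanishes-cong n
      (solve 3 (λ s w p → w :* p :* s := w :* s :* p) refl (s μ) (ι (weight μ)) (ι (sp μ)))
      (vanishes-* n (ι (weight μ) * ι (sp μ)) (s μ)
        (proj₂ Δˣ-regular (suc m) (s μ) (vanishes-cong n
          (trans (sym (s-schur μ)) (*-comm (s μ) Δˣ))
          (vanishes-≤ n
            (ℕ.≤-reflexive (ℕ.+-comm d (suc m)))
            (vanishes-schurNumerator n (λ i → i) μ (m ℕ.+ d) unbounded)))))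

    coeff-Σ : {X : Set} (xs : List X) (f : X → Carrier) (α : Vec ℕ n) →
      coeff (Laurent n) (Σ[ xs ] f) α A.≈ A.Σ[ xs ] (λ z → coeff (Laurent n) (f z) α)
    coeff-Σ []       f α = coeff-0 n α
    coeff-Σ (z ∷ xs) f α = A.trans (coeff-+ n (f z) (Σ[ xs ] f) α) (A.+-congˡ (coeff-Σ xs f α))

    -- The bound grows with the degree of `α`; by `summand-vanishes` the partitions beyond it
    -- contribute nothing to this coefficient.
    total : Carrier
    total = fromCoeff n λ α →
      A.Σ[ partitionsUpTo n (Vec.sum α ℕ.+ d) ] (λ μ → coeff (Laurent n) (summand μ) α)

    hasSum : HasSum (Laurent n) n summand total
    hasSum α =
      partitionsUpTo n (Vec.sum α ℕ.+ d) ,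
      partitionsUpTo-unique n (Vec.sum α ℕ.+ d) ,
      (λ μ μ∉ → summand-vanishes (Vec.sum α) μ (∉partitionsUpTo μ μ∉) α ℕ.≤-refl) ,
      A.reflexive (coeff-fromCoeff n _ α)

    -- For `α` of degree below `m` the list up to `m + d` contains the one that defines `total` at
    -- `α`, and its further members have coefficient 0 there.
    total-truncation : ∀ m → Vanishes n m (total - Σ[ partitionsUpTo n (m ℕ.+ d) ] summand)
    total-truncation m α α<m = A.trans (coeff-+ n total _ α) (A.trans
      (A.+-cong (A.reflexive (coeff-fromCoeff n _ α)) (A.trans (coeff-neg n _ α) (A.-‿cong tail)))
      (A.-‿inverseʳ (A.Σ[ partitionsUpTo n b ] f)))
      where
      f : Partition n → A.Carrier
      f μ = coeff (Laurent n) (summand μ) α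

      b : ℕ
      b = Vec.sum α ℕ.+ d

      bound : m ℕ.+ d ≡ (m ∸ Vec.sum α) ℕ.+ b
      bound = ≡.trans (≡.cong (ℕ._+ d) (≡.sym (ℕ.m∸n+n≡m (ℕ.<⇒≤ α<m))))
        (ℕ.+-assoc (m ∸ Vec.sum α) (Vec.sum α) d)

      tail : coeff (Laurent n) (Σ[ partitionsUpTo n (m ℕ.+ d) ] summand) α
             A.≈ A.Σ[ partitionsUpTo n b ] f
      tail = A.trans (coeff-Σ (partitionsUpTo n (m ℕ.+ d)) summand α)
        (A.trans (A.reflexive (≡.cong (λ k → A.Σ[ partitionsUpTo n k ] f) bound))
          (StableSums.Σ-partitionsUpTo-≤ _ isCommRingᴬ n (m ∸ Vec.sum α) b f
            (λ μ unbounded → summand-vanishes (Vec.sum α) μ unbounded α ℕ.≤-refl)))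

    total-identity : total * D ≈ product factor * det kernel
    total-identity = begin
      total * D                  ≈⟨ a-b+b≈a _ _ ⟨
      total * D - RHS + RHS      ≈⟨ +-congʳ difference≈0 ⟩
      0# + RHS                   ≈⟨ +-identityˡ RHS ⟩
      RHS                        ∎
      where
      open ≈-Reasoning
      RHS : Carrier
      RHS = product factor * det kernel

      congruent : ∀ m → Vanishes n m (total * D * ι V - RHS * ι V)
      congruent m =
        ∼-trans (∼-reflexive (trans (*-assoc total D (ι V)) (*-comm total (D * ι V))))
        (∼-trans (*-cong-∼ (∼-reflexive (refl {D * ι V})) (total-truncation m))
        (∼-trans (∼-reflexive (finite-identity (m ℕ.+ d)))
        (truncated-det m ((m ℕ.+ d) ℕ.+ n)
          (ℕ.≤-trans (ℕ.m≤m+n m d) (ℕ.m≤m+n (m ℕ.+ d) n)))))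
        where open Congruence n m

      difference≈0 : total * D - RHS ≈ 0#
      -- The congruences for all `m` make the difference times `ι V` zero. As `V` is constant in the
      -- `x i`, it is cancelled in each coefficient separately.
      difference≈0 = const-nonZeroDivisor n {V}
        (product-nonZeroDivisor _ isCommRingᴬ (λ i → y i A.- ȳ i)
          (LaurentRing.y-ȳ-nonZeroDivisor n))
        (total * D - RHS)
        (trans (*-comm (ι V) _) (trans ([y-z]x≈yx-zx (ι V) (total * D) RHS)
          (vanishes-all n _ congruent)))

theorem3 : (n : ℕ) → 1 ≤ n →
    let open FormalSeries n in
    (s : Partition n → Carrier) → (∀ μ → IsSchurPolynomial μ (s μ)) →
    (sp : Partition n → A.Carrier) → (∀ μ → IsSymplecticCharacter μ (sp μ)) →
    ∃[ F ]
    HasSum (Laurent n) n (λ μ → ι (weight μ) * s μ * ι (sp μ)) F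
    × (F ≈ product (λ i → 1# - ι t * x i ^ 2)
    * det (λ i j → ι (A.1# A.- t)
    * 1/[1- y j ·x i ] * 1/[1- t A.* y j ·x i ]
    * 1/[1- ȳ j ·x i ] * 1/[1- t A.* ȳ j ·x i ])
    ÷ product< (λ i j → x i - x j)
    * ι (A.product< (λ i j → y i A.- y j))
    * ι (A.product< (λ i j → A.1# A.- ȳ i A.* ȳ j)))
theorem3 n _ s s-schur sp sp-symplectic =
  total s s-schur sp sp-symplectic ,
  hasSum s s-schur sp sp-symplectic ,
  total-identity s s-schur sp sp-symplectic
  where open Identity n
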